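{- Let $(W,S)$ be a Coxeter system with $S$ finite and $\theta$ an involutive automorphism of $(W,S)$. Let $u\le v$ be elements of $\iota(\theta)$. If $u\star s=us$ for some $s\in D_R(v)$, then the order complex of the open interval $(u,v)=\{x\in\iota(\theta)\mid u<x<v\}$ in $\mathrm{Br}(\iota(\theta))$ is collapsible.
   Context: An automorphism of $(W,S)$ is a group automorphism of $W$ mapping $S$ onto $S$; involutive means $\theta^2=\mathrm{id}$. Twisted identities: $\iota(\theta)=\{\theta(w^{ -1})w\mid w\in W\}$. For $w\in W$, $s\in S$: $w\star s=ws$ if $\theta(s)ws=w$, else $w\star s=\theta(s)ws$. $D_R(w)=\{s\in S\mid \ell(ws)<\ell(w)\}$, $\ell$ the Coxeter length. Bruhat order: $u\le v$ iff for every reduced expression $s_1\cdots s_k$ of $v$ there are $i_1<\cdots<i_m$ with $u=s_{i_1}\cdots s_{i_m}$; $\mathrm{Br}(\iota(\theta))$ is its restriction to $\iota(\theta)$. The order complex of a finite poset is the simplicial complex of its chains. -}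

module Defs where

open import Data.Nat using (ℕ; zero; suc; _≤_; _<_)
open import Data.Fin using (Fin)
open import Data.Maybe using (Maybe; just; nothing)
open import Data.List using (List; []; _∷_; _++_; [_]; reverse; length)
open import Data.Product using (Σ; _×_; _,_; ∃; ∃-syntax)
open import Data.Sum using (_⊎_)
open import Relation.Nullary using (¬_)
open import Relation.Binary.PropositionalEquality using (_≡_; _≢_)
open import Relation.Binary.Construct.Closure.Equivalence using (EqClosure)
open import Data.List.Relation.Binary.Sublist.Heterogeneous using (Sublist)
open import Data.List.Relation.Binary.Pointwise using (Pointwise)
open import Data.List.Relation.Unary.All using (All)
open import Data.List.Relation.Unary.Linked using (Linked)

-- Coxeter matrices on the finite generating set S = Fin n.
-- m s t = nothing encodes m(s,t) = ∞.

record CoxeterMatrix (n : ℕ) : Set where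
  field
    m        : Fin n → Fin n → Maybe ℕ
    diag     : ∀ s → m s s ≡ just 1
    symm     : ∀ s t → m s t ≡ m t s
    offdiag  : ∀ s t → s ≢ t → ∀ k → m s t ≡ just k → 2 ≤ k

-- The Coxeter system (W,S) given by a Coxeter matrix:
-- W = words in S modulo the Coxeter presentation
-- ⟨ S | s² = 1, (st)^{m(s,t)} = 1 ⟩, presented (equivalently, since
-- generators are involutions) by the relations ss = 1 and the braid
-- relations sts… = tst… (m(s,t) letters on each side, m finite).
-- Elements of W are words, equality in W is the setoid relation _≈_.

module Coxeter {n : ℕ} (M : CoxeterMatrix n) where
  open CoxeterMatrix M

  Word : Set
  Word = List (Fin n)

  alt : Fin n → Fin n → ℕ → Word
  alt s t zero    = []
  alt s t (suc k) = s ∷ alt t s k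

  data Step : Word → Word → Set where
    cancel : ∀ xs ys s → Step (xs ++ s ∷ s ∷ ys) (xs ++ ys)
    braid  : ∀ xs ys s t k → m s t ≡ just k →
             Step (xs ++ alt s t k ++ ys) (xs ++ alt t s k ++ ys)

  _≈_ : Word → Word → Set
  _≈_ = EqClosure Step

  _·_ : Word → Word → Word
  x · y = x ++ y

  inv : Word → Word
  inv = reverse

  Reduced : Word → Set
  Reduced r = ∀ r' → r' ≈ r → length r ≤ length r'

  HasLength : Word → ℕ → Set
  HasLength w k = Σ Word λ r → r ≈ w × Reduced r × length r ≡ k

  RightDescent : Word → Fin n → Set
  RightDescent w s = ∃[ k ] ∃[ k' ] (HasLength w k × HasLength (w · [ s ]) k' × k' < k)

  _≤B_ : Word → Word → Set
  u ≤B v = ∀ r → r ≈ v → Reduced r → Σ Word λ x → Sublist _≡_ x r × x ≈ u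

  _<B_ : Word → Word → Set
  u <B v = u ≤B v × ¬ (u ≈ v)

  record Automorphism : Set where
    field
      θ        : Word → Word
      θ-cong   : ∀ {x y} → x ≈ y → θ x ≈ θ y
      θ-hom    : ∀ x y → θ (x · y) ≈ (θ x · θ y)
      θ-inj    : ∀ {x y} → θ x ≈ θ y → x ≈ y
      θ-surj   : ∀ y → Σ Word λ x → θ x ≈ y
      θ-S      : ∀ s → Σ (Fin n) λ t → θ [ s ] ≈ [ t ]
      θ-S-onto : ∀ t → Σ (Fin n) λ s → θ [ s ] ≈ [ t ]

  Involutive : Automorphism → Set
  Involutive A = ∀ w → θ (θ w) ≈ w
    where open Automorphism A

  module Twisted (A : Automorphism) where
    open Automorphism A

    IsTwistedIdentity : Word → Set
    IsTwistedIdentity x = Σ Word λ w → x ≈ (θ (inv w) · w)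

    StarIs : Word → Fin n → Word → Set
    StarIs w s x =
        ((θ [ s ] · (w · [ s ])) ≈ w × x ≈ (w · [ s ]))
      ⊎ (¬ ((θ [ s ] · (w · [ s ])) ≈ w) × x ≈ (θ [ s ] · (w · [ s ])))

    InOpenInterval : Word → Word → Word → Set
    InOpenInterval u v x = IsTwistedIdentity x × u <B x × x <B v

    OrderComplexOpenInterval : Word → Word → List Word → Set
    OrderComplexOpenInterval u v σ =
      ¬ (σ ≡ []) × All (InOpenInterval u v) σ × Linked _<B_ σ

-- Collapsibility of a (finite) simplicial complex.
-- A complex is given by its predicate of (nonempty) faces, each face
-- being a list of vertices in a fixed order (for an order complex:
-- increasing order), vertices compared with a setoid relation _≈_;
-- face inclusion is sublist inclusion.
-- An elementary collapse removes a free face σ together with the unique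
-- face τ properly containing σ (dim τ = dim σ + 1). K is collapsible if
-- a finite sequence of elementary collapses reduces it to one vertex.

module Collapse {V : Set} (_≈_ : V → V → Set) where

  _≋_ : List V → List V → Set
  _≋_ = Pointwise _≈_

  _⊂_ : List V → List V → Set
  σ ⊂ ρ = Sublist _≈_ σ ρ × length σ < length ρ

  Remove : (List V → Set) → List V → List V → (List V → Set)
  Remove K σ τ ρ = K ρ × ¬ (ρ ≋ σ) × ¬ (ρ ≋ τ)

  data Collapsible (K : List V → Set) : Set₁ where
    point : (x : V) → (∀ ρ → K ρ → ρ ≋ [ x ]) → (∀ ρ → ρ ≋ [ x ] → K ρ) →
            Collapsible K
    collapse : (σ τ : List V) → K σ → K τ →
               σ ⊂ τ → length τ ≡ suc (length σ) →
               (∀ ρ → K ρ → σ ⊂ ρ → ρ ≋ τ) →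
               Collapsible (Remove K σ τ) →
               Collapsible K

{-# OPTIONS --safe #-}
module Submission where

open import Defs
open import Data.Bool using (Bool; true; false; not; _xor_)
import Data.Bool.Properties as Bool
open import Data.Empty using (⊥)
open import Data.Fin as Fin using (Fin)
open import Data.List using (List; []; _∷_; _++_; [_]; length; map; filter; initLast; _∷ʳ′_;
  applyUpTo; applyDownFrom; cartesianProductWith)
import Data.List.Properties as List
import Data.List.Relation.Binary.Permutation.Propositional as Perm
import Data.List.Relation.Binary.Permutation.Propositional.Properties as Perm
import Data.List.Relation.Binary.Permutation.Setoid as Permutation
import Data.List.Relation.Binary.Permutation.Setoid.Properties as PermutationProperties
open import Data.List.Relation.Binary.Pointwise as PW using (Pointwise; []; _∷_)
open import Data.List.Relation.Binary.Sublist.Heterogeneous using (Sublist; []; _∷_; _∷ʳ_; minimum)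
import Data.List.Relation.Binary.Sublist.Heterogeneous.Properties as Sub
open import Data.List.Relation.Unary.All as All using (All; []; _∷_)
import Data.List.Relation.Unary.All.Properties as All
open import Data.List.Relation.Unary.AllPairs using (AllPairs; []; _∷_)
open import Data.List.Relation.Unary.Any as Any using (Any; here; there)
import Data.List.Relation.Unary.Any.Properties as Any
open import Data.List.Relation.Unary.Linked as Linked using (Linked; []; [-]; _∷_)
import Data.List.Relation.Unary.Linked.Properties as Linked
import Data.List.Sort
open import Data.Maybe using (Maybe; just; nothing)
open import Data.Maybe.Properties using (just-injective)
open import Data.Nat as ℕ using (ℕ; zero; suc; _≤_; _<_; z≤n; s≤s)
open import Data.Nat.Divisibility using (_∣_; _∣?_; ∣m+n∣m⇒∣n; ∣m∣n⇒∣m+n; n∣m*n; ∣⇒≤; ∣-refl)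
open import Data.Nat.DivMod using (_%_; _/_; m≡m%n+[m/n]*n; m%n<n)
import Data.Nat.Properties as ℕ
open import Data.Product using (Σ; _×_; _,_; ∃; proj₁; proj₂)
open import Data.Sum as Sum using (_⊎_; inj₁; inj₂)
open import Function using (_∘_; id; mk⇔)
open import Relation.Binary using (Decidable; DecTotalOrder; IsEquivalence; IsStrictPartialOrder; Setoid; _Respects_)
import Relation.Binary.Construct.Closure.Equivalence as EqC
open import Relation.Binary.Construct.Closure.ReflexiveTransitive using (ε; _◅_)
open import Relation.Binary.Construct.Closure.Symmetric using (module SymClosure)
import Relation.Binary.Construct.Flip.EqAndOrd as Flip
import Relation.Binary.Construct.On as On
open import Relation.Binary.PropositionalEquality using (_≡_; _≢_; refl; sym; trans; cong; cong₂; subst; subst₂;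
  _≗_; module ≡-Reasoning)
import Relation.Binary.Reasoning.Setoid as SetoidReasoning
open import Relation.Nullary using (¬_; Dec; yes; no; does; ¬?; _×-dec_; _⊎-dec_; contradiction)
open import Relation.Nullary.Decidable using (map′; does-⇔; dec-true; dec-false; decidable-stable)

-- Call x ∈ ι(θ) low if s is not a right descent of x.  If s is a
-- descent of x ∈ ι(θ), then θ(s) x s ≠ x, because the reflection w s w⁻¹ with
-- x = θ(w⁻¹) w would otherwise be fixed by θ and s would occur evenly often
-- among the inversions of x⁻¹.  Hence M(x) = θ(s) x s has length ℓ(x) - 2, is
-- low, and by the lifting property is the greatest low twisted identity below
-- x.  The hypothesis on u says θ(s) u s = u, so u is low and u < M(x) for every
-- x > u with descent s.  Removing the elements of (u,v) that are not low, in
-- order of increasing length, removes at each step a vertex x whose link is a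
-- cone with apex M(x); the low elements left form a cone with apex M(v).
--
-- The complex is given by words, so equality in W has to be decided.  The
-- reflections attached to a word, modulo cancellation of equal pairs, depend
-- only on the group element; a perfect matching of equal reflections then
-- yields the deletion condition without deciding equality.  Together with the
-- fact that s t has order exactly m(s,t) it computes the descents of a reduced
-- word by recursion.  That fact is proved with the formulas of the geometric
-- representation, where 2 cos (π / k) is replaced by the adjacency operator of
-- a disjoint union of paths with k - 1 vertices, acting on sequences of
-- integers.  The operators for different k need not commute.

-- Collapsing order complexes

-- The obstacle is that everything must be computed on words. A list of faces is finite only up to
-- `_≈_`, so each stage of the collapse asks for membership up to `_≈_`, and equality, the order and
-- twisted identities must all be decidable. The decision starts from descents: a reduced word
-- ending in s has a second descent t only if it ends in the alternating word of s and t of length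
-- m(s,t). That test rests on all alternating words up to this length being reduced. The
-- presentation bounds the order of s t only from above, so a lower bound has to come from an action
-- of the group. A path on k - 1 vertices replaces it because its adjacency matrix has 2 cos (π / k)
-- as largest eigenvalue, and its characteristic polynomial is the Chebyshev polynomial whose
-- vanishing the braid relation needs. Infinitely many copies of the path, rather than one, let the
-- operators for different k act on the same space.

module _ {V : Set} {_≈_ : V → V → Set} where
  open Collapse _≈_

  Collapsible-resp : {K L : List V → Set} → (∀ ρ → K ρ → L ρ) → (∀ ρ → L ρ → K ρ) →
                     Collapsible K → Collapsible L
  Collapsible-resp f g (point x only has) =
    point x (λ ρ → only ρ ∘ g ρ) (λ ρ → f ρ ∘ has ρ)
  Collapsible-resp f g (collapse σ τ Kσ Kτ σ⊂τ len free c) =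
    collapse σ τ (f σ Kσ) (f τ Kτ) σ⊂τ len (λ ρ → free ρ ∘ g ρ)
      (Collapsible-resp (λ ρ (k , r) → f ρ k , r) (λ ρ (k , r) → g ρ k , r) c)

module Ranked {A : Set} (rank : A → ℕ) where

  ≤-on : DecTotalOrder _ _ _
  ≤-on = On.decTotalOrder ℕ.≤-decTotalOrder rank

  sort-by : (xs : List A) →
            ∃ λ ys → AllPairs (λ x y → rank x ≤ rank y) ys × ys Perm.↭ xs
  sort-by xs = sort xs , Linked.Linked⇒AllPairs ℕ.≤-trans (sort-↗ xs) , sort-↭ xs
    where open Data.List.Sort ≤-on

  sort-by-desc : (xs : List A) →
                 ∃ λ ys → AllPairs (λ x y → rank y ≤ rank x) ys × ys Perm.↭ xs
  sort-by-desc xs = sort xs , Linked.Linked⇒AllPairs (λ p q → ℕ.≤-trans q p) (sort-↗ xs) , sort-↭ xs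
    where open Data.List.Sort (Flip.decTotalOrder ≤-on)

module PosetCollapse
  {V : Set} (_≈_ _≺_ : V → V → Set)
  (≺-isStrictPartialOrder : IsStrictPartialOrder _≈_ _≺_)
  (_≈?_ : Decidable _≈_) (_≺?_ : Decidable _≺_)
  (ht : V → ℕ) (ht-cong : ∀ {x y} → x ≈ y → ht x ≡ ht y)
  (ht-mono : ∀ {x y} → x ≺ y → ht x < ht y)
  where

  open import Data.Nat using (_+_)
  open IsStrictPartialOrder ≺-isStrictPartialOrder
    renaming (module Eq to ≈; trans to ≺-trans; irrefl to ≺-irrefl)
  open Collapse _≈_

  OrderComplex : (V → Set) → List V → Set
  OrderComplex P ρ = ¬ (ρ ≡ []) × All P ρ × Linked _≺_ ρ

  OrderComplex-resp : {P Q : V → Set} → (∀ {y} → P y → Q y) →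
                      ∀ ρ → OrderComplex P ρ → OrderComplex Q ρ
  OrderComplex-resp f ρ (ne , all , ch) = ne , All.map f all , ch

  Comparable : V → V → Set
  Comparable x y = x ≺ y ⊎ x ≈ y ⊎ y ≺ x

  ≋-refl : ∀ {ρ} → ρ ≋ ρ
  ≋-refl = PW.refl ≈.refl

  ≋-sym : ∀ {ρ σ} → ρ ≋ σ → σ ≋ ρ
  ≋-sym = PW.symmetric ≈.sym

  ≋-trans : ∀ {ρ σ τ} → ρ ≋ σ → σ ≋ τ → ρ ≋ τ
  ≋-trans = PW.transitive ≈.trans

  _≋?_ : Decidable _≋_
  _≋?_ = PW.decidable _≈?_

  All-resp-≋ : {P : V → Set} → P Respects _≈_ → (All P) Respects _≋_
  All-resp-≋ r []       []       = []
  All-resp-≋ r (e ∷ es) (p ∷ ps) = r e p ∷ All-resp-≋ r es ps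

  Linked-resp-≋ : (Linked _≺_) Respects _≋_
  Linked-resp-≋ []           []       = []
  Linked-resp-≋ (_ ∷ [])     [-]      = [-]
  Linked-resp-≋ (e ∷ f ∷ es) (r ∷ rs) =
    <-respˡ-≈ e (<-respʳ-≈ f r) ∷ Linked-resp-≋ (f ∷ es) rs

  OrderComplex-resp-≋ : {P : V → Set} → P Respects _≈_ → (OrderComplex P) Respects _≋_
  OrderComplex-resp-≋ r []        (ne , _)        = ne , [] , []
  OrderComplex-resp-≋ r es@(_ ∷ _) (ne , all , ch) =
    (λ ()) , All-resp-≋ r es all , Linked-resp-≋ es ch

  Any-resp-≋ : ∀ {x} → (Any (x ≈_)) Respects _≋_
  Any-resp-≋ (e ∷ es) (here p)  = here (≈.trans p e)
  Any-resp-≋ (e ∷ es) (there p) = there (Any-resp-≋ es p)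

  -- Heights increase strictly along a chain, so each vertex uses up one unit between `ht x` and
  -- `B`. This bounds the length of faces and makes their enumeration finite.
  chain-length : ∀ {B x ρ} → All (λ y → ht y < B) (x ∷ ρ) → Linked _≺_ (x ∷ ρ) →
                 ht x + length (x ∷ ρ) ≤ B
  chain-length {B} {x} (p ∷ []) [-] rewrite ℕ.+-comm (ht x) 1 = p
  chain-length {B} {x} {y ∷ ρ} (p ∷ ps) (r ∷ rs) rewrite ℕ.+-suc (ht x) (suc (length ρ)) =
    ℕ.≤-trans (ℕ.+-monoˡ-≤ (suc (length ρ)) (ht-mono r)) (chain-length ps rs)

  listsUpTo : ℕ → List V → List (List V)
  listsUpTo zero    L = [ [] ]
  listsUpTo (suc d) L = [] ∷ cartesianProductWith _∷_ L (listsUpTo d L)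

  listsUpTo-complete : ∀ d {L} ρ → length ρ ≤ d → All (λ y → Any (y ≈_) L) ρ →
                       Any (ρ ≋_) (listsUpTo d L)
  listsUpTo-complete zero    []      _       _        = here []
  listsUpTo-complete (suc d) []      _       _        = here []
  listsUpTo-complete (suc d) (y ∷ ρ) (s≤s l) (p ∷ ps) =
    there (Any.cartesianProductWith⁺ _∷_ _∷_ p (listsUpTo-complete d ρ l ps))

  module _ (a : V) where

    insert : List V → List V
    insert []       = [ a ]
    insert (y ∷ ys) with a ≺? y
    ... | yes _ = a ∷ y ∷ ys
    ... | no  _ = y ∷ insert ys

    ≉a? : ∀ y → Dec (¬ (y ≈ a))
    ≉a? y = ¬? (y ≈? a)

    without : List V → List V
    without = filter ≉a?

    insert-length : ∀ ρ → length (insert ρ) ≡ suc (length ρ)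
    insert-length []      = refl
    insert-length (y ∷ ρ) with a ≺? y
    ... | yes _ = refl
    ... | no  _ = cong suc (insert-length ρ)

    insert-⊇ : ∀ ρ → Sublist _≈_ ρ (insert ρ)
    insert-⊇ []      = a ∷ʳ []
    insert-⊇ (y ∷ ρ) with a ≺? y
    ... | yes _ = a ∷ʳ Sub.refl ≈.refl
    ... | no  _ = ≈.refl ∷ insert-⊇ ρ

    insert-cong : ∀ {ρ σ} → ρ ≋ σ → insert ρ ≋ insert σ
    insert-cong [] = ≋-refl
    insert-cong {y ∷ _} {z ∷ _} (e ∷ es) with a ≺? y | a ≺? z
    ... | yes _ | yes _ = ≈.refl ∷ e ∷ es
    ... | no  _ | no  _ = e ∷ insert-cong es
    ... | yes p | no ¬q = contradiction (<-respʳ-≈ e p) ¬q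
    ... | no ¬p | yes q = contradiction (<-respʳ-≈ (≈.sym e) q) ¬p

    insert-All : {P : V → Set} → P a → ∀ {ρ} → All P ρ → All P (insert ρ)
    insert-All pa [] = pa ∷ []
    insert-All pa {y ∷ _} (p ∷ ps) with a ≺? y
    ... | yes _ = pa ∷ p ∷ ps
    ... | no  _ = p ∷ insert-All pa ps

    insert-AllPairs : ∀ {ρ} → AllPairs _≺_ ρ → All (λ y → Comparable y a) ρ →
                      All (λ y → ¬ (y ≈ a)) ρ → AllPairs _≺_ (insert ρ)
    insert-AllPairs [] _ _ = [] ∷ []
    insert-AllPairs {y ∷ _} (r ∷ rs) (c ∷ cs) (n ∷ ns) with a ≺? y
    ... | yes a≺y = (a≺y ∷ All.map (≺-trans a≺y) r) ∷ r ∷ rs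
    ... | no  a⊀y = insert-All (below c) r ∷ insert-AllPairs rs cs ns
      where
      below : Comparable y a → y ≺ a
      below (inj₁ y≺a)        = y≺a
      below (inj₂ (inj₁ y≈a)) = contradiction y≈a n
      below (inj₂ (inj₂ a≺y)) = contradiction a≺y a⊀y

    without-insert : ∀ {ρ} → All (λ y → ¬ (y ≈ a)) ρ → without (insert ρ) ≡ ρ
    without-insert [] = List.filter-reject ≉a? (λ n → n ≈.refl)
    without-insert {y ∷ ρ} (n ∷ ns) with a ≺? y
    ... | yes _ = trans (List.filter-reject ≉a? (λ n → n ≈.refl)) (List.filter-all ≉a? (n ∷ ns))
    ... | no  _ = trans (List.filter-accept ≉a? n) (cong (y ∷_) (without-insert ns))

    without-cong : ∀ {ρ σ} → ρ ≋ σ → without ρ ≋ without σ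
    without-cong []       = []
    without-cong {y ∷ _} {z ∷ _} (e ∷ es) with y ≈? a | z ≈? a
    ... | yes _ | yes _ = without-cong es
    ... | no  _ | no  _ = e ∷ without-cong es
    ... | yes p | no ¬q = contradiction (≈.trans (≈.sym e) p) ¬q
    ... | no ¬p | yes q = contradiction (≈.trans e q) ¬p

    Any-without : ∀ {x} → ¬ (x ≈ a) → ∀ {ρ} → Any (x ≈_) ρ → Any (x ≈_) (without ρ)
    Any-without n {y ∷ _} (here p) with y ≈? a
    ... | yes q = contradiction (≈.trans p q) n
    ... | no  _ = here p
    Any-without n {y ∷ _} (there p) with y ≈? a
    ... | yes _ = Any-without n p
    ... | no  _ = there (Any-without n p)

    ∉⇒without : ∀ {ρ} → ¬ Any (a ≈_) ρ → without ρ ≡ ρ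
    ∉⇒without a∉ρ = List.filter-all ≉a? (All.map (λ n → n ∘ ≈.sym) (All.¬Any⇒All¬ _ a∉ρ))

    -- The position of `a` in a chain is forced by the order, so a face through `a` can be recovered
    -- from the rest of it.
    insert-without : ∀ {ρ} → AllPairs _≺_ ρ → Any (a ≈_) ρ → ρ ≋ insert (without ρ)
    insert-without {y ∷ ρ} (r ∷ rs) p with y ≈? a
    ... | yes y≈a rewrite List.filter-all ≉a? (All.map (λ y≺z z≈a → ≺-irrefl (≈.trans y≈a (≈.sym z≈a)) y≺z) r) =
      front ρ r
      where
      front : ∀ ρ → All (y ≺_) ρ → (y ∷ ρ) ≋ insert ρ
      front []      _       = y≈a ∷ []
      front (z ∷ ρ) (l ∷ _) with a ≺? z
      ... | yes _ = y≈a ∷ ≋-refl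
      ... | no ¬l = contradiction (<-respˡ-≈ y≈a l) ¬l
    insert-without {y ∷ ρ} (r ∷ rs) (here a≈y) | no y≉a = contradiction (≈.sym a≈y) y≉a
    insert-without {y ∷ ρ} (r ∷ rs) (there p)  | no y≉a with a ≺? y
    ... | yes a≺y = contradiction
      (All.lookupWith (λ y≺z a≈z → <-respʳ-≈ (≈.sym a≈z) y≺z) r p)
      (λ y≺a → ≺-irrefl ≈.refl (≺-trans a≺y y≺a))
    ... | no  _   = ≈.refl ∷ insert-without rs p

  -- Removing a vertex whose link is a cone

  module RemoveVertex
    {P : V → Set} (P-resp : P Respects _≈_) (P? : ∀ y → Dec (P y))
    (L : List V) (P⊆L : ∀ {y} → P y → Any (y ≈_) L)
    (B : ℕ) (P<B : ∀ {y} → P y → ht y < B)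
    {x a : V} (Pa : P a) (x≉a : ¬ (x ≈ a))
    (dominated : ∀ {y} → P y → Comparable y x → Comparable y a)
    where

    -- Of the faces through `x`, those remain whose part away from `a` is listed in `σs`. A face and
    -- its partner with `a` added share that part, so they leave together.
    Stage : List (List V) → List V → Set
    Stage σs ρ = OrderComplex P ρ × (Any (x ≈_) ρ → Any (without a ρ ≋_) σs)

    -- Faces have length at most `B` and entries in `L` up to `_≈_`, so finitely many candidate
    -- lists cover them. Candidates that are not faces are sorted out by `Free?` later.
    stage-start : ∃ λ σs → AllPairs (λ σ τ → length τ ≤ length σ) σs ×
                  (∀ ρ → OrderComplex P ρ → Any (without a ρ ≋_) σs)
    stage-start with Ranked.sort-by-desc length (listsUpTo B L)
    ... | σs , sorted , perm = σs , sorted , λ ρ (_ , all , ch) →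
      Perm.Any-resp-↭ (Perm.↭-sym perm)
        (listsUpTo-complete B (without a ρ)
          (bound (All.filter⁺ (≉a? a) all) (Linked.filter⁺ (≉a? a) ≺-trans ch))
          (All.map P⊆L (All.filter⁺ (≉a? a) all)))
      where
      bound : ∀ {ρ} → All P ρ → Linked _≺_ ρ → length ρ ≤ B
      bound {[]} _ _ = z≤n
      bound {y ∷ ρ} all ch = ℕ.≤-trans (ℕ.m≤n+m _ (ht y)) (chain-length (All.map P<B all) ch)

    Free : List V → Set
    Free σ = OrderComplex P σ × Any (x ≈_) σ × ¬ Any (a ≈_) σ

    Free? : ∀ σ → Dec (Free σ)
    Free? σ = (nonempty? σ ×-dec All.all? P? σ ×-dec Linked.linked? _≺?_ σ)
      ×-dec Any.any? (x ≈?_) σ ×-dec ¬? (Any.any? (a ≈?_) σ)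
      where
      nonempty? : ∀ σ → Dec (¬ (σ ≡ []))
      nonempty? []      = no (λ n → n refl)
      nonempty? (_ ∷ _) = yes λ ()

    without-free : ∀ {ρ} → OrderComplex P ρ → Any (x ≈_) ρ → Free (without a ρ)
    without-free {ρ} (_ , all , ch) p =
      ((λ e → nonempty e (Any-without a x≉a p)) , All.filter⁺ (≉a? a) all , Linked.filter⁺ (≉a? a) ≺-trans ch)
      , Any-without a x≉a p
      , All.All¬⇒¬Any (All.map (λ n → n ∘ ≈.sym) (All.all-filter (≉a? a) ρ))
      where
      nonempty : ∀ {ρ} → ρ ≡ [] → ¬ Any (x ≈_) ρ
      nonempty refl ()

    Free-resp-≋ : Free Respects _≋_
    Free-resp-≋ e (K , p , q) =
      OrderComplex-resp-≋ P-resp e K , Any-resp-≋ e p , q ∘ Any-resp-≋ (≋-sym e)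

    chain : ∀ {ρ} → OrderComplex P ρ → AllPairs _≺_ ρ
    chain (_ , _ , ch) = Linked.Linked⇒AllPairs ≺-trans ch

    insert-face : ∀ {σ} → Free σ → OrderComplex P (insert a σ)
    insert-face {σ} (K@(ne , all , ch) , p , a∉σ) =
      nonempty , insert-All a Pa all ,
      Linked.AllPairs⇒Linked
        (insert-AllPairs a (chain K) (All.zipWith (λ (y∈P , c) → dominated y∈P c) (all , comparable (chain K) p))
          (All.map (λ n → n ∘ ≈.sym) (All.¬Any⇒All¬ _ a∉σ)))
      where
      nonempty : ¬ (insert a σ ≡ [])
      nonempty e with () ← trans (sym (insert-length a σ)) (cong length e)
      comparable : ∀ {ρ} → AllPairs _≺_ ρ → Any (x ≈_) ρ → All (λ y → Comparable y x) ρ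
      comparable (r ∷ rs) (here x≈y) =
        inj₂ (inj₁ (≈.sym x≈y)) ∷ All.map (λ y≺z → inj₂ (inj₂ (<-respˡ-≈ (≈.sym x≈y) y≺z))) r
      comparable {y ∷ _} (r ∷ rs) (there p) =
        inj₁ (All.lookupWith (λ y≺z x≈z → <-respʳ-≈ (≈.sym x≈z) y≺z) r p) ∷ comparable rs p

    without-≡ : ∀ {σ} → Free σ → without a σ ≡ σ
    without-≡ (_ , _ , a∉σ) = ∉⇒without a a∉σ

    without-insert-≡ : ∀ {σ} → Free σ → without a (insert a σ) ≡ σ
    without-insert-≡ (_ , _ , a∉σ) =
      without-insert a (All.map (λ n → n ∘ ≈.sym) (All.¬Any⇒All¬ _ a∉σ))

    -- The faces containing x are matched by adding or deleting the apex a.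
    -- Deleting the pairs in order of decreasing dimension keeps each lower
    -- face free.
    remove-pairs : ∀ σs → AllPairs (λ σ τ → length τ ≤ length σ) σs →
                   Collapsible (Stage []) → Collapsible (Stage σs)
    remove-pairs []       _        c = c
    remove-pairs (σ ∷ σs) (s ∷ ss) c with Free? σ ×-dec ¬? (Any.any? (σ ≋?_) σs)
    -- A candidate that is not a suitable face, or that recurs later up to `_≋_`, is dropped without
    -- changing the complex. A repeated one has to wait for its last occurrence, since otherwise the
    -- rest of the list would still admit the removed pair.
    ... | no ¬good = Collapsible-resp
      (λ ρ (K , f) → K , there ∘ f)
      (λ ρ (K , f) → K , λ p → skip K p (f p))
      (remove-pairs σs ss c)
      where
      skip : ∀ {ρ} → OrderComplex P ρ → Any (x ≈_) ρ →
             Any (without a ρ ≋_) (σ ∷ σs) → Any (without a ρ ≋_) σs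
      skip K p (there q) = q
      skip K p (here e) with Any.any? (σ ≋?_) σs
      ... | yes q = Any.map (≋-trans e) q
      ... | no ¬q = contradiction (Free-resp-≋ e (without-free K p) , ¬q) ¬good
    ... | yes (F@(K , x∈σ , a∉σ) , σ∉σs) =
      collapse σ (insert a σ)
        (K , λ _ → here (PW-≡ (without-≡ F)))
        (insert-face F , λ _ → here (PW-≡ (without-insert-≡ F)))
        (insert-⊇ a σ , ℕ.≤-reflexive (sym (insert-length a σ)))
        (insert-length a σ)
        free
        (Collapsible-resp to from (remove-pairs σs ss c))
      where
      PW-≡ : ∀ {ρ τ} → ρ ≡ τ → ρ ≋ τ
      PW-≡ refl = ≋-refl

      completed : ∀ {ρ} → OrderComplex P ρ → without a ρ ≋ σ → ρ ≋ σ ⊎ ρ ≋ insert a σ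
      completed {ρ} Kρ e with Any.any? (a ≈?_) ρ
      ... | yes a∈ρ = inj₂ (≋-trans (insert-without a (chain Kρ) a∈ρ) (insert-cong a e))
      ... | no  a∉ρ = inj₁ (subst (_≋ σ) (∉⇒without a a∉ρ) e)

      shorter : ∀ {ρ} → Any (ρ ≋_) (σ ∷ σs) → length ρ ≤ length σ
      shorter (here e)  = ℕ.≤-reflexive (PW.Pointwise-length e)
      shorter (there p) = All.lookupWith
        (λ l e → ℕ.≤-trans (ℕ.≤-reflexive (PW.Pointwise-length e)) l) s p

      free : ∀ ρ → Stage (σ ∷ σs) ρ → σ ⊂ ρ → ρ ≋ insert a σ
      free ρ (Kρ , f) (σ⊆ρ , len) with completed Kρ (≋-sym σ≋)
        where
        x∈ρ : Any (x ≈_) ρ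
        x∈ρ = Sublist-lookup σ⊆ρ x∈σ
          where
          Sublist-lookup : ∀ {σ ρ} → Sublist _≈_ σ ρ → Any (x ≈_) σ → Any (x ≈_) ρ
          Sublist-lookup (_ ∷ʳ r) p         = there (Sublist-lookup r p)
          Sublist-lookup (e ∷ r)  (here p)  = here (≈.trans p e)
          Sublist-lookup (e ∷ r)  (there p) = there (Sublist-lookup r p)
        σ⊆ : Sublist _≈_ σ (without a ρ)
        σ⊆ = subst (λ - → Sublist _≈_ - (without a ρ)) (without-≡ F)
               (Sub.⊆-filter-Sublist (≉a? a) (≉a? a) (λ e n → n ∘ ≈.trans e) σ⊆ρ)
        σ≋ : σ ≋ without a ρ
        σ≋ = Sub.toPointwise (ℕ.≤-antisym (Sub.length-mono-≤ σ⊆) (shorter (f x∈ρ))) σ⊆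
      ... | inj₂ e = e
      ... | inj₁ e = contradiction (PW.Pointwise-length e) (ℕ.>⇒≢ len)

      to : ∀ ρ → Stage σs ρ → Remove (Stage (σ ∷ σs)) σ (insert a σ) ρ
      to ρ (Kρ , f) = (Kρ , there ∘ f)
        , (λ e → absurd e x∈σ (PW-≡ (without-≡ F)))
        , (λ e → absurd e (Any-insert x∈σ) (PW-≡ (without-insert-≡ F)))
        where
        Any-insert : ∀ {σ} → Any (x ≈_) σ → Any (x ≈_) (insert a σ)
        Any-insert {y ∷ _} p with a ≺? y
        ... | yes _ = there p
        Any-insert {y ∷ _} (here p)  | no _ = here p
        Any-insert {y ∷ _} (there p) | no _ = there (Any-insert p)
        absurd : ∀ {τ} → ρ ≋ τ → Any (x ≈_) τ → without a τ ≋ σ → ⊥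
        absurd e p e′ = σ∉σs (Any.map (≋-trans (≋-sym (≋-trans (without-cong a e) e′)))
                               (f (Any-resp-≋ (≋-sym e) p)))

      from : ∀ ρ → Remove (Stage (σ ∷ σs)) σ (insert a σ) ρ → Stage σs ρ
      from ρ ((Kρ , f) , ρ≭σ , ρ≭τ) = Kρ , λ p → tail (f p)
        where
        tail : Any (without a ρ ≋_) (σ ∷ σs) → Any (without a ρ ≋_) σs
        tail (there q) = q
        tail (here e) with completed Kρ e
        ... | inj₁ e′ = contradiction e′ ρ≭σ
        ... | inj₂ e′ = contradiction e′ ρ≭τ

    removeVertex : Collapsible (OrderComplex (λ y → P y × ¬ (y ≈ x))) →
                   Collapsible (OrderComplex P)
    removeVertex c with stage-start
    ... | σs , sorted , complete = Collapsible-resp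
      (λ ρ → proj₁) (λ ρ K → K , λ _ → complete ρ K)
      (remove-pairs σs sorted (Collapsible-resp to from c))
      where
      to : ∀ ρ → OrderComplex (λ y → P y × ¬ (y ≈ x)) ρ → Stage [] ρ
      to ρ (ne , all , ch) = (ne , All.map proj₁ all , ch)
        , λ p → contradiction p (All.All¬⇒¬Any (All.map (λ (_ , n) → n ∘ ≈.sym) all))
      from : ∀ ρ → Stage [] ρ → OrderComplex (λ y → P y × ¬ (y ≈ x)) ρ
      from ρ ((ne , all , ch) , f) = ne
        , All.zip (all , All.map (λ n → n ∘ ≈.sym) (All.¬Any⇒All¬ _ (λ p → impossible (f p)))) , ch
        where
        impossible : ∀ {τ} → ¬ Any (τ ≋_) []
        impossible ()

  -- Collapsing onto the fixed elements, and these onto a point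

  module Retraction
    {Q Fix : V → Set} (Q-resp : Q Respects _≈_) (Fix-resp : Fix Respects _≈_)
    (Q? : ∀ y → Dec (Q y)) (Fix? : ∀ y → Dec (Fix y))
    (L : List V) (Q⊆L : ∀ {y} → Q y → Any (y ≈_) L)
    (B : ℕ) (Q<B : ∀ {y} → Q y → ht y < B)
    (retract : ∀ {x} → Q x → ¬ Fix x →
       ∃ λ a → Q a × Fix a × a ≺ x × (∀ {y} → Q y → Fix y → y ≺ x → Comparable y a))
    (c : V) (Qc : Q c) (Fix-c : Fix c) (top : ∀ {y} → Q y → Fix y → Comparable y c)
    where

    ∈-resp : ∀ {xs} → (λ y → Any (y ≈_) xs) Respects _≈_
    ∈-resp e = Any.map (≈.trans (≈.sym e))

    Cone : List V → V → Set
    Cone xs y = (Q y × Fix y) × (y ≈ c ⊎ Any (y ≈_) xs)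

    -- Every vertex is comparable with `c`, so `c` cones off the link of each other vertex, and the
    -- vertices can be removed one at a time in the order of the list.
    cone-collapsible : ∀ xs → Collapsible (OrderComplex (Cone xs))
    cone-collapsible [] = point c only has
      where
      has : ∀ ρ → ρ ≋ [ c ] → OrderComplex (Cone []) ρ
      has (y ∷ []) (e ∷ []) = (λ ()) , ((Q-resp (≈.sym e) Qc , Fix-resp (≈.sym e) Fix-c) , inj₁ e) ∷ [] , [-]
      only : ∀ ρ → OrderComplex (Cone []) ρ → ρ ≋ [ c ]
      only [] (ne , _) = contradiction refl ne
      only (y ∷ []) (_ , (_ , inj₁ e) ∷ [] , _) = e ∷ []
      only (y ∷ z ∷ _) (_ , (_ , inj₁ e) ∷ (_ , inj₁ e′) ∷ _ , r ∷ _) =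
        contradiction r (≺-irrefl (≈.trans e (≈.sym e′)))
    cone-collapsible (x ∷ xs) with (x ≈? c) ⊎-dec Any.any? (x ≈?_) xs
    ... | yes p = Collapsible-resp
      (OrderComplex-resp (λ { (q , r) → q , widen r })) (OrderComplex-resp (λ { (q , r) → q , narrow r }))
      (cone-collapsible xs)
      where
      widen : ∀ {y} → y ≈ c ⊎ Any (y ≈_) xs → y ≈ c ⊎ Any (y ≈_) (x ∷ xs)
      widen (inj₁ e) = inj₁ e
      widen (inj₂ q) = inj₂ (there q)
      narrow : ∀ {y} → y ≈ c ⊎ Any (y ≈_) (x ∷ xs) → y ≈ c ⊎ Any (y ≈_) xs
      narrow (inj₁ e)         = inj₁ e
      narrow (inj₂ (there q)) = inj₂ q
      narrow (inj₂ (here e))  = Sum.map (≈.trans e) (∈-resp (≈.sym e)) p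
    ... | no ¬p = removeHead (Collapsible-resp
      (OrderComplex-resp λ { (q , r) → (q , widen r) , λ e → ¬p (back e r) })
      (OrderComplex-resp λ { ((q , r) , n) → q , narrow n r })
      (cone-collapsible xs))
      where
      removeHead = RemoveVertex.removeVertex
        {Cone (x ∷ xs)}
        (λ { e ((q , f) , inj₁ r) → (Q-resp e q , Fix-resp e f) , inj₁ (≈.trans (≈.sym e) r)
           ; e ((q , f) , inj₂ r) → (Q-resp e q , Fix-resp e f) , inj₂ (∈-resp e r) })
        (λ y → (Q? y ×-dec Fix? y) ×-dec ((y ≈? c) ⊎-dec Any.any? (y ≈?_) (x ∷ xs)))
        L (λ ((q , _) , _) → Q⊆L q) B (λ ((q , _) , _) → Q<B q)
        {x} {c} ((Qc , Fix-c) , inj₁ ≈.refl) (λ e → ¬p (inj₁ e))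
        (λ ((q , f) , _) _ → top q f)
      widen : ∀ {y} → y ≈ c ⊎ Any (y ≈_) xs → y ≈ c ⊎ Any (y ≈_) (x ∷ xs)
      widen (inj₁ e) = inj₁ e
      widen (inj₂ q) = inj₂ (there q)
      back : ∀ {y} → y ≈ x → y ≈ c ⊎ Any (y ≈_) xs → x ≈ c ⊎ Any (x ≈_) xs
      back e (inj₁ e′) = inj₁ (≈.trans (≈.sym e) e′)
      back e (inj₂ q)  = inj₂ (∈-resp e q)
      narrow : ∀ {y} → ¬ (y ≈ x) → y ≈ c ⊎ Any (y ≈_) (x ∷ xs) → y ≈ c ⊎ Any (y ≈_) xs
      narrow n (inj₁ e)         = inj₁ e
      narrow n (inj₂ (here e))  = contradiction e n
      narrow n (inj₂ (there q)) = inj₂ q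

    Partial : List V → V → Set
    Partial xs y = Q y × (Fix y ⊎ Any (y ≈_) xs)

    -- The head `x` has least height among the listed elements. So whatever is still present below
    -- `x` is fixed and comparable with the retract `a`, while everything above `x` is above `a`.
    partial-collapsible : ∀ xs → AllPairs (λ x y → ht x ≤ ht y) xs →
                          Collapsible (OrderComplex (Partial xs))
    partial-collapsible [] _ = Collapsible-resp
      (OrderComplex-resp λ ((q , f) , _) → q , inj₁ f)
      (OrderComplex-resp λ { (q , inj₁ f) → (q , f) , inj₂ (Q⊆L q) })
      (cone-collapsible L)
    partial-collapsible (x ∷ xs) (s ∷ ss) with Q? x ×-dec ¬? (Fix? x) ×-dec ¬? (Any.any? (x ≈?_) xs)
    ... | no ¬p = Collapsible-resp
      (OrderComplex-resp λ { (q , inj₁ f) → q , inj₁ f ; (q , inj₂ r) → q , inj₂ (there r) })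
      (OrderComplex-resp narrow)
      (partial-collapsible xs ss)
      where
      narrow : ∀ {y} → Partial (x ∷ xs) y → Partial xs y
      narrow (q , inj₁ f)         = q , inj₁ f
      narrow (q , inj₂ (there r)) = q , inj₂ r
      narrow {y} (q , inj₂ (here e)) with Fix? y | Any.any? (y ≈?_) xs
      ... | yes f | _     = q , inj₁ f
      ... | no  _ | yes r = q , inj₂ r
      ... | no ¬f | no ¬r = contradiction
        (Q-resp e q , ¬f ∘ Fix-resp (≈.sym e) , ¬r ∘ ∈-resp (≈.sym e)) ¬p
    ... | yes (Qx , ¬Fx , x∉xs) with retract Qx ¬Fx
    ... | a , Qa , Fa , a≺x , below = removeHead (Collapsible-resp
      (OrderComplex-resp λ { (q , inj₁ f) → (q , inj₁ f) , λ e → ¬Fx (Fix-resp e f)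
                           ; (q , inj₂ r) → (q , inj₂ (there r)) , λ e → x∉xs (∈-resp e r) })
      (OrderComplex-resp λ { ((q , inj₁ f) , _) → q , inj₁ f
                           ; ((q , inj₂ (here e)) , n) → contradiction e n
                           ; ((q , inj₂ (there r)) , _) → q , inj₂ r })
      (partial-collapsible xs ss))
      where
      dominated : ∀ {y} → Partial (x ∷ xs) y → Comparable y x → Comparable y a
      dominated p (inj₂ (inj₁ y≈x)) = inj₂ (inj₂ (<-respʳ-≈ (≈.sym y≈x) a≺x))
      dominated p (inj₂ (inj₂ x≺y)) = inj₂ (inj₂ (≺-trans a≺x x≺y))
      dominated (q , inj₁ f) (inj₁ y≺x) = below q f y≺x
      dominated (q , inj₂ (here e)) (inj₁ y≺x) = contradiction y≺x (≺-irrefl e)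
      dominated (q , inj₂ (there r)) (inj₁ y≺x) = contradiction
        (All.lookupWith (λ l e → ℕ.≤-trans l (ℕ.≤-reflexive (sym (ht-cong e)))) s r)
        (ℕ.<⇒≱ (ht-mono y≺x))
      removeHead = RemoveVertex.removeVertex
        {Partial (x ∷ xs)}
        (λ { e (q , inj₁ f) → Q-resp e q , inj₁ (Fix-resp e f)
           ; e (q , inj₂ r) → Q-resp e q , inj₂ (∈-resp e r) })
        (λ y → Q? y ×-dec (Fix? y ⊎-dec Any.any? (y ≈?_) (x ∷ xs)))
        L (λ (q , _) → Q⊆L q) B (λ (q , _) → Q<B q)
        {x} {a} (Qa , inj₁ Fa) (λ e → ≺-irrefl (≈.sym e) a≺x) dominated

    collapsible : Collapsible (OrderComplex Q)
    collapsible with Ranked.sort-by ht L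
    ... | xs , sorted , perm = Collapsible-resp
      (OrderComplex-resp proj₁)
      (OrderComplex-resp λ q → q , inj₂ (Perm.Any-resp-↭ (Perm.↭-sym perm) (Q⊆L q)))
      (partial-collapsible xs sorted)

-- Reflections and the deletion condition

module CoxeterGroup {n : ℕ} (M : CoxeterMatrix n) where
  open import Data.Nat using (_+_)
  open CoxeterMatrix M public
  open Coxeter M public

  ≈-setoid : Setoid _ _
  ≈-setoid = EqC.setoid Step

  module ≈ = Setoid ≈-setoid
  module ≈-Reasoning = SetoidReasoning ≈-setoid

  step : ∀ {w w′} → Step w w′ → w ≈ w′
  step p = SymClosure.fwd p ◅ ε

  Step-++ˡ : ∀ x {w w′} → Step w w′ → Step (x ++ w) (x ++ w′)
  Step-++ˡ x (cancel xs ys s) = subst₂ Step (List.++-assoc x xs _) (List.++-assoc x xs _)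
    (cancel (x ++ xs) ys s)
  Step-++ˡ x (braid xs ys s t k e) = subst₂ Step (List.++-assoc x xs _) (List.++-assoc x xs _)
    (braid (x ++ xs) ys s t k e)

  Step-++ʳ : ∀ y {w w′} → Step w w′ → Step (w ++ y) (w′ ++ y)
  Step-++ʳ y (cancel xs ys s) = subst₂ Step (sym (List.++-assoc xs _ y)) (sym (List.++-assoc xs _ y))
    (cancel xs (ys ++ y) s)
  Step-++ʳ y (braid xs ys s t k e) = subst₂ Step (assoc (alt s t k)) (assoc (alt t s k))
    (braid xs (ys ++ y) s t k e)
    where
    assoc : ∀ a → xs ++ a ++ ys ++ y ≡ (xs ++ a ++ ys) ++ y
    assoc a = trans (cong (xs ++_) (sym (List.++-assoc a ys y))) (sym (List.++-assoc xs (a ++ ys) y))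

  ++-congˡ : ∀ x {w w′} → w ≈ w′ → (x ++ w) ≈ (x ++ w′)
  ++-congˡ x = EqC.gmap (x ++_) (Step-++ˡ x)

  ++-congʳ : ∀ y {w w′} → w ≈ w′ → (w ++ y) ≈ (w′ ++ y)
  ++-congʳ y = EqC.gmap (_++ y) (Step-++ʳ y)

  ++-cong : ∀ {w w′ y y′} → w ≈ w′ → y ≈ y′ → (w ++ y) ≈ (w′ ++ y′)
  ++-cong {w′ = w′} {y = y} p q = ≈.trans (++-congʳ y p) (++-congˡ w′ q)

  ∷-cong : ∀ s {w w′} → w ≈ w′ → (s ∷ w) ≈ (s ∷ w′)
  ∷-cong s = ++-congˡ [ s ]

  ss≈ : ∀ s w → (s ∷ s ∷ w) ≈ w
  ss≈ s w = step (cancel [] w s)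

  assoc : ∀ x y z → ((x ++ y) ++ z) ≈ (x ++ y ++ z)
  assoc x y z = ≈.reflexive (List.++-assoc x y z)

  ++-[] : ∀ x → (x ++ []) ≈ x
  ++-[] x = ≈.reflexive (List.++-identityʳ x)

  alt-braid : ∀ {s t k} → m s t ≡ just k → alt s t k ≈ alt t s k
  alt-braid {s} {t} {k} e = subst₂ _≈_ (List.++-identityʳ _) (List.++-identityʳ _)
    (step (braid [] [] s t k e))

  inv-∷ : ∀ s w → inv (s ∷ w) ≡ inv w ++ [ s ]
  inv-∷ s w = List.unfold-reverse s w

  inv-++ : ∀ x y → inv (x ++ y) ≡ inv y ++ inv x
  inv-++ = List.reverse-++

  inv-inv : ∀ x → inv (inv x) ≡ x
  inv-inv = List.reverse-involutive

  inverseʳ : ∀ w → (w ++ inv w) ≈ []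
  inverseʳ []      = ≈.refl
  inverseʳ (s ∷ w) = begin
    s ∷ w ++ inv (s ∷ w)     ≡⟨ cong (λ - → s ∷ w ++ -) (inv-∷ s w) ⟩
    s ∷ w ++ inv w ++ [ s ]  ≡⟨ cong (s ∷_) (List.++-assoc w (inv w) _) ⟨
    s ∷ (w ++ inv w) ++ [ s ] ≈⟨ ∷-cong s (++-congʳ [ s ] (inverseʳ w)) ⟩
    s ∷ [ s ]                ≈⟨ ss≈ s [] ⟩
    []                       ∎
    where open ≈-Reasoning

  inverseˡ : ∀ w → (inv w ++ w) ≈ []
  inverseˡ w = subst (λ - → (inv w ++ -) ≈ []) (inv-inv w) (inverseʳ (inv w))

  cancelˡ : ∀ x {w w′} → (x ++ w) ≈ (x ++ w′) → w ≈ w′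
  cancelˡ x {w} {w′} p = begin
    w                  ≈⟨ ++-congʳ w (inverseˡ x) ⟨
    (inv x ++ x) ++ w  ≈⟨ assoc (inv x) x w ⟩
    inv x ++ x ++ w    ≈⟨ ++-congˡ (inv x) p ⟩
    inv x ++ x ++ w′   ≈⟨ assoc (inv x) x w′ ⟨
    (inv x ++ x) ++ w′ ≈⟨ ++-congʳ w′ (inverseˡ x) ⟩
    w′                 ∎
    where open ≈-Reasoning

  cancelʳ : ∀ y {w w′} → (w ++ y) ≈ (w′ ++ y) → w ≈ w′
  cancelʳ y {w} {w′} p = begin
    w                  ≈⟨ ++-[] w ⟨
    w ++ []            ≈⟨ ++-congˡ w (inverseʳ y) ⟨
    w ++ y ++ inv y    ≈⟨ assoc w y (inv y) ⟨
    (w ++ y) ++ inv y  ≈⟨ ++-congʳ (inv y) p ⟩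
    (w′ ++ y) ++ inv y ≈⟨ assoc w′ y (inv y) ⟩
    w′ ++ y ++ inv y   ≈⟨ ++-congˡ w′ (inverseʳ y) ⟩
    w′ ++ []           ≈⟨ ++-[] w′ ⟩
    w′                 ∎
    where open ≈-Reasoning

  inv-cong : ∀ {w w′} → w ≈ w′ → inv w ≈ inv w′
  inv-cong {w} {w′} p = cancelˡ w (≈.trans (inverseʳ w) (≈.sym (≈.trans (++-congʳ (inv w′) p) (inverseʳ w′))))

  snoc-swap : ∀ {w w′ s} → w ≈ (w′ ++ [ s ]) → (w ++ [ s ]) ≈ w′
  snoc-swap {w} {w′} {s} p = begin
    w ++ [ s ]           ≈⟨ ++-congʳ [ s ] p ⟩
    (w′ ++ [ s ]) ++ [ s ] ≈⟨ assoc w′ [ s ] [ s ] ⟩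
    w′ ++ s ∷ s ∷ []     ≈⟨ ++-congˡ w′ (ss≈ s []) ⟩
    w′ ++ []             ≈⟨ ++-[] w′ ⟩
    w′                   ∎
    where open ≈-Reasoning

  conj : Fin n → Word → Word
  conj a t = a ∷ t ++ [ a ]

  conj-cong : ∀ a {t t′} → t ≈ t′ → conj a t ≈ conj a t′
  conj-cong a p = ∷-cong a (++-congʳ [ a ] p)

  conj-conj : ∀ a t → conj a (conj a t) ≈ t
  conj-conj a t = ≈.trans (ss≈ a _) (snoc-swap ≈.refl)

  conj-swap : ∀ a {t t′} → t ≈ conj a t′ → conj a t ≈ t′
  conj-swap a {t} {t′} p = ≈.trans (conj-cong a p) (conj-conj a t′)

  -- Each letter contributes its conjugate by the letters before it. For a reduced word these are
  -- the left inversions of the element.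
  reflections : Word → List Word
  reflections []      = []
  reflections (a ∷ w) = [ a ] ∷ map (conj a) (reflections w)

  length-reflections : ∀ w → length (reflections w) ≡ length w
  length-reflections []      = refl
  length-reflections (a ∷ w) = cong suc (trans (List.length-map (conj a) (reflections w)) (length-reflections w))

  -- The conjugating prefix cancels: `t` moves past the letters `b` and turns into the letter `y`
  -- that produced it. So multiplying the word by `t` on the left deletes `y`.
  reflection-split : ∀ {t} w → Any (t ≈_) (reflections w) →
    ∃ λ b → ∃ λ y → ∃ λ c → w ≡ b ++ y ∷ c × (t ++ b) ≈ (b ++ [ y ])
  reflection-split (a ∷ w) (here p) = [] , a , w , refl , ≈.trans (++-[] _) p
  reflection-split {t} (a ∷ w) (there p)
    with reflection-split {conj a t} w (Any.map (conj-swap a) (Any.map⁻ p))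
  ... | b , y , c , refl , q = a ∷ b , y , c , refl , (begin
    t ++ a ∷ b                    ≈⟨ ss≈ a _ ⟨
    a ∷ a ∷ t ++ a ∷ b            ≡⟨ cong (λ - → a ∷ a ∷ -) (List.++-assoc t [ a ] b) ⟨
    a ∷ conj a t ++ b             ≈⟨ ∷-cong a q ⟩
    a ∷ b ++ [ y ]                ∎)
    where open ≈-Reasoning

  -- Lists of reflections modulo cancellation of pairs

  open Permutation ≈-setoid using (_↭_; ↭-refl; ↭-sym; ↭-trans; ↭-prep; ↭-reflexive; ↭-reflexive-≋)
  module ↭ = PermutationProperties ≈-setoid

  Paired : List Word → Set
  Paired xs = ∃ λ zs → xs ↭ zs ++ zs

  Paired-resp : ∀ {xs ys} → xs ↭ ys → Paired xs → Paired ys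
  Paired-resp p (zs , q) = zs , ↭-trans (↭-sym p) q

  extract : ∀ {x xs} → Any (x ≈_) xs → ∃ λ ys → xs ↭ x ∷ ys
  extract (here {xs = xs} p) = xs , Permutation.prep (≈.sym p) ↭-refl
  extract {x} (there {y} p) with extract p
  ... | ys , q = y ∷ ys , ↭-trans (↭-prep y q) (Permutation.↭-swap ≈-setoid y x ↭-refl)

  -- Up to permutation `zs` contains `x`, so the doubled list contains it twice; dropping one copy
  -- leaves a partner inside `xs`. The partner comes from the permutation, not from a search.
  Paired-uncons : ∀ {x xs} → Paired (x ∷ xs) → ∃ λ ys → xs ↭ x ∷ ys × Paired ys
  Paired-uncons {x} {xs} (zs , p) with extract {xs = zs} (Sum.[ id , id ] (Any.++⁻ zs x∈))
    where
    x∈ : Any (x ≈_) (zs ++ zs)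
    x∈ = ↭.∈-resp-↭ p (here ≈.refl)
  ... | ys , q = ys ++ ys , ↭.drop-∷ (↭-trans p split) , ys , ↭-refl
    where
    split : zs ++ zs ↭ x ∷ x ∷ ys ++ ys
    split = ↭-trans (↭.++⁺ q q) (↭-prep x (↭.↭-shift ys ys))

  Paired-drop₂ : ∀ {x xs} → Paired (x ∷ x ∷ xs) → Paired xs
  Paired-drop₂ p with Paired-uncons p
  ... | ys , q , r = Paired-resp (↭-sym (↭.drop-∷ q)) r

  Paired-drop-++ : ∀ ys {xs} → Paired (ys ++ ys ++ xs) → Paired xs
  Paired-drop-++ []           p = p
  Paired-drop-++ (y ∷ ys) {xs} p =
    Paired-drop-++ ys (Paired-drop₂ (Paired-resp (↭-prep y (↭.↭-shift ys (ys ++ xs))) p))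

  -- Equality of multisets modulo 2, expressed as a matching of the concatenation. It is transitive
  -- because the middle list then occurs twice and cancels.
  _∼_ : List Word → List Word → Set
  xs ∼ ys = Paired (xs ++ ys)

  ↭⇒∼ : ∀ {xs ys} → xs ↭ ys → xs ∼ ys
  ↭⇒∼ {xs} {ys} p = ys , ↭.++⁺ʳ ys p

  ∼-isEquivalence : IsEquivalence _∼_
  ∼-isEquivalence = record
    { refl  = λ {xs} → ↭⇒∼ {xs} ↭-refl
    ; sym   = λ {xs} {ys} → Paired-resp (↭.++-comm xs ys)
    ; trans = λ {xs} {ys} {zs} (ps , p) (qs , q) → Paired-drop-++ ys
        (Paired-resp
          (↭-trans (↭.++⁺ (↭.++-comm xs ys) ↭-refl)
            (↭-trans (↭-reflexive (List.++-assoc ys xs (ys ++ zs))) (↭.++⁺ˡ ys (↭.shifts xs ys))))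
          (ps ++ qs , ↭-trans (↭.++⁺ p q) (interchange ps qs)))
    }
    where
    interchange : ∀ ps qs → (ps ++ ps) ++ qs ++ qs ↭ (ps ++ qs) ++ ps ++ qs
    interchange ps qs =
      ↭-trans (↭-reflexive (List.++-assoc ps ps _))
        (↭-trans (↭.++⁺ˡ ps (↭.shifts ps qs)) (↭-reflexive (sym (List.++-assoc ps qs _))))

  module ∼ = IsEquivalence ∼-isEquivalence

  reflections-∷ : ∀ a {w w′} → reflections w ∼ reflections w′ →
                  reflections (a ∷ w) ∼ reflections (a ∷ w′)
  reflections-∷ a {w} {w′} (zs , p) = [ a ] ∷ map (conj a) zs , (begin
    [ a ] ∷ map (conj a) (reflections w) ++ [ a ] ∷ map (conj a) (reflections w′)
      ↭⟨ ↭-prep _ (↭.↭-shift (map (conj a) (reflections w)) _) ⟩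
    [ a ] ∷ [ a ] ∷ map (conj a) (reflections w) ++ map (conj a) (reflections w′)
      ≡⟨ cong (λ - → [ a ] ∷ [ a ] ∷ -) (List.map-++ (conj a) (reflections w) (reflections w′)) ⟨
    [ a ] ∷ [ a ] ∷ map (conj a) (reflections w ++ reflections w′)
      ↭⟨ ↭-prep _ (↭-prep _ (↭.map⁺ ≈-setoid (conj-cong a) p)) ⟩
    [ a ] ∷ [ a ] ∷ map (conj a) (zs ++ zs)
      ≡⟨ cong (λ - → [ a ] ∷ [ a ] ∷ -) (List.map-++ (conj a) zs zs) ⟩
    [ a ] ∷ [ a ] ∷ map (conj a) zs ++ map (conj a) zs
      ↭⟨ ↭-prep _ (↭.↭-shift (map (conj a) zs) _) ⟨
    [ a ] ∷ map (conj a) zs ++ [ a ] ∷ map (conj a) zs ∎)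
    where open Permutation.PermutationReasoning ≈-setoid

  conjBy : Word → Word → Word
  conjBy x t = x ++ t ++ inv x

  conj-conjBy : ∀ a x t → conj a (conjBy x t) ≡ conjBy (a ∷ x) t
  conj-conjBy a x t = cong (a ∷_) (begin
    (x ++ t ++ inv x) ++ [ a ] ≡⟨ List.++-assoc x (t ++ inv x) [ a ] ⟩
    x ++ (t ++ inv x) ++ [ a ] ≡⟨ cong (x ++_) (List.++-assoc t (inv x) [ a ]) ⟩
    x ++ t ++ inv x ++ [ a ]   ≡⟨ cong (λ - → x ++ t ++ -) (inv-∷ a x) ⟨
    x ++ t ++ inv (a ∷ x)      ∎)
    where open ≡-Reasoning

  reflections-++ : ∀ x y → Pointwise _≈_ (reflections (x ++ y))
                           (reflections x ++ map (conjBy x) (reflections y))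
  reflections-++ [] y = lemma (reflections y)
    where
    lemma : ∀ ts → Pointwise _≈_ ts (map (conjBy []) ts)
    lemma []       = []
    lemma (t ∷ ts) = ≈.sym (++-[] t) ∷ lemma ts
  reflections-++ (a ∷ x) y = ≈.refl ∷ PW.transitive ≈.trans
    (PW.map⁺ (conj a) (conj a) (PW.map (conj-cong a) (reflections-++ x y)))
    (lemma (reflections x) (reflections y))
    where
    lemma : ∀ us ts → Pointwise _≈_ (map (conj a) (us ++ map (conjBy x) ts))
                        (map (conj a) us ++ map (conjBy (a ∷ x)) ts)
    lemma []       []       = []
    lemma []       (t ∷ ts) = ≈.reflexive (conj-conjBy a x t) ∷ lemma [] ts
    lemma (u ∷ us) ts       = ≈.refl ∷ lemma us ts

  module _ {s t : Fin n} {k : ℕ} (eq : alt s t k ≈ alt t s k) where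

    -- Each letter put in front beyond length `k` cancels a letter on the other side of the braid
    -- relation, so the element gets shorter again.
    alt-fold : ∀ i j → i + j ≡ k → alt s t (k + i) ≈ alt t s j × alt t s (k + i) ≈ alt s t j
    alt-fold zero    j refl rewrite ℕ.+-identityʳ j = eq , ≈.sym eq
    alt-fold (suc i) j e with alt-fold i (suc j) (trans (ℕ.+-suc i j) e)
    ... | p , q rewrite ℕ.+-suc k i =
      ≈.trans (∷-cong s q) (ss≈ s _) , ≈.trans (∷-cong t p) (ss≈ t _)

    alt-complement : ∀ i j → i + j ≡ k + k → alt s t i ≈ alt t s j
    alt-complement i j e with ℕ.≤-total k i
    ... | inj₁ k≤i with ℕ.m≤n⇒∃[o]m+o≡n k≤i
    ...   | o , refl = proj₁ (alt-fold o j (ℕ.+-cancelˡ-≡ k _ _ (trans (sym (ℕ.+-assoc k o j)) e)))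
    alt-complement i j e | inj₂ i≤k with ℕ.m≤n⇒∃[o]m+o≡n (k≤j i≤k)
      where
      k≤j : i ≤ k → k ≤ j
      k≤j i≤k = ℕ.+-cancelˡ-≤ k k j (ℕ.≤-trans (ℕ.≤-reflexive (sym e)) (ℕ.+-monoˡ-≤ j i≤k))
    ... | o , refl = ≈.sym (proj₂ (alt-fold o i (ℕ.+-cancelˡ-≡ k _ _ (trans (lemma o) e))))
      where
      lemma : ∀ o → k + (o + i) ≡ i + (k + o)
      lemma o = trans (sym (ℕ.+-assoc k o i)) (ℕ.+-comm (k + o) i)

  alt-snoc : ∀ s t i → alt s t (i + i) ++ [ s ] ≡ alt s t (suc (i + i))
  alt-snoc s t zero    = refl
  alt-snoc s t (suc i) rewrite ℕ.+-suc i i = cong (λ w → s ∷ t ∷ w) (alt-snoc s t i)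

  applyUpTo-cong : ∀ {A : Set} {f g : ℕ → A} → (∀ i → f i ≡ g i) → ∀ k → applyUpTo f k ≡ applyUpTo g k
  applyUpTo-cong e zero    = refl
  applyUpTo-cong e (suc k) = cong₂ _∷_ (e 0) (applyUpTo-cong (e ∘ suc) k)

  -- Alternating words of odd length are palindromes; these are the reflections of the dihedral
  -- subgroup, counted from zero.
  altReflection : Fin n → Fin n → ℕ → Word
  altReflection s t i = alt s t (suc (i + i))

  conj-altReflection : ∀ s t i → conj s (altReflection t s i) ≡ altReflection s t (suc i)
  conj-altReflection s t i rewrite ℕ.+-suc i i = cong (λ w → s ∷ t ∷ w) (alt-snoc s t i)

  reflections-alt : ∀ s t k → reflections (alt s t k) ≡ applyUpTo (altReflection s t) k
  reflections-alt s t zero    = refl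
  reflections-alt s t (suc k) = cong ([ s ] ∷_) (begin
    map (conj s) (reflections (alt t s k))
      ≡⟨ cong (map (conj s)) (reflections-alt t s k) ⟩
    map (conj s) (applyUpTo (altReflection t s) k)
      ≡⟨ List.map-applyUpTo (altReflection t s) (conj s) k ⟩
    applyUpTo (conj s ∘ altReflection t s) k
      ≡⟨ applyUpTo-cong (conj-altReflection s t) k ⟩
    applyUpTo (altReflection s t ∘ suc) k ∎)
    where open ≡-Reasoning

  -- The braid relation reverses the list of reflections.
  reflections-braid : ∀ {s t k} → m s t ≡ just k →
                      reflections (alt s t k) ↭ reflections (alt t s k)
  reflections-braid {s} {t} {k} e
    rewrite reflections-alt s t k | reflections-alt t s k =
    ↭-trans (↭-sym (↭.↭-reverse _))
      (↭-trans (↭-reflexive (List.reverse-applyUpTo _ k))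
        -- Reflections number i and k - 1 - i have lengths 2 i + 1 and 2 (k - 1 - i) + 1, which add
        -- up to 2 k as `alt-complement` requires.
        (↭-reflexive-≋ (reversed k λ i j e′ → alt-complement (alt-braid e) _ _ (double i j e′))))
    where
    reversed : ∀ {f g : ℕ → Word} k → (∀ i j → suc (i + j) ≡ k → f i ≈ g j) →
               Pointwise _≈_ (applyDownFrom f k) (applyUpTo g k)
    reversed zero    h = []
    reversed (suc k) h = h k 0 (cong suc (ℕ.+-identityʳ k))
      ∷ reversed k (λ i j e → h i (suc j) (cong suc (trans (ℕ.+-suc i j) e)))
    double : ∀ i j {k} → suc (i + j) ≡ k → suc (i + i) + suc (j + j) ≡ k + k
    double i j refl = cong suc (begin
      i + i + suc (j + j)   ≡⟨ ℕ.+-suc (i + i) (j + j) ⟩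
      suc (i + i + (j + j)) ≡⟨ cong suc (ℕ.+-assoc i i (j + j)) ⟩
      suc (i + (i + (j + j))) ≡⟨ cong (λ - → suc (i + -)) (sym (ℕ.+-assoc i j j)) ⟩
      suc (i + (i + j + j)) ≡⟨ cong (λ - → suc (i + -)) (ℕ.+-comm (i + j) j) ⟩
      suc (i + (j + (i + j))) ≡⟨ cong suc (sym (ℕ.+-assoc i j (i + j))) ⟩
      suc (i + j + (i + j)) ≡⟨ ℕ.+-suc (i + j) (i + j) ⟨
      i + j + suc (i + j) ∎)
      where open ≡-Reasoning

  -- Cancelling `s s` removes the equal entries `[ s ]` and `conj s [ s ]` and leaves the rest
  -- conjugated twice by `s`. A braid move permutes the entries of the braid and keeps the
  -- conjugating prefix of the tail up to `_≈_`.
  reflections-step : ∀ {w w′} → Step w w′ → reflections w ∼ reflections w′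
  reflections-step (cancel (x ∷ xs) ys s) = reflections-∷ x {xs ++ s ∷ s ∷ ys} {xs ++ ys} (reflections-step (cancel xs ys s))
  reflections-step (braid (x ∷ xs) ys s t k e) =
    reflections-∷ x {xs ++ alt s t k ++ ys} {xs ++ alt t s k ++ ys} (reflections-step (braid xs ys s t k e))
  reflections-step (cancel [] ys s) =
    [ s ] ∷ reflections ys , ↭-trans
      (↭-prep _ (Permutation.prep (ss≈ s [ s ])
        (↭.++⁺ʳ (reflections ys) (↭-reflexive-≋ (twice (reflections ys))))))
      (↭-prep _ (↭-sym (↭.↭-shift (reflections ys) _)))
    where
    twice : ∀ ts → Pointwise _≈_ (map (conj s) (map (conj s) ts)) ts
    twice []       = []
    twice (t ∷ ts) = conj-conj s t ∷ twice ts
  reflections-step (braid [] ys s t k e) = ↭⇒∼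
    (↭-trans (↭-reflexive-≋ (reflections-++ (alt s t k) ys))
      (↭-trans (↭.++⁺ (reflections-braid e) (↭-reflexive-≋ (same (reflections ys))))
        (↭-sym (↭-reflexive-≋ (reflections-++ (alt t s k) ys)))))
    where
    same : ∀ ts → Pointwise _≈_ (map (conjBy (alt s t k)) ts) (map (conjBy (alt t s k)) ts)
    same []       = []
    same (r ∷ ts) = ++-cong (alt-braid e) (++-congˡ r (inv-cong (alt-braid e))) ∷ same ts

  reflections-cong : ∀ {w w′} → w ≈ w′ → reflections w ∼ reflections w′
  reflections-cong = EqC.gfold ∼-isEquivalence reflections reflections-step

  data Repeats : List Word → Set where
    here  : ∀ {x xs} → Any (x ≈_) xs → Repeats (x ∷ xs)
    there : ∀ {x xs} → Repeats xs → Repeats (x ∷ xs)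

  Repeats-conj⁻ : ∀ a {ts} → Repeats (map (conj a) ts) → Repeats ts
  Repeats-conj⁻ a {t ∷ ts} (here p)  = here (Any.map (λ q → ≈.trans (≈.sym (conj-conj a t)) (conj-swap a q)) (Any.map⁻ p))
  Repeats-conj⁻ a {t ∷ ts} (there p) = there (Repeats-conj⁻ a p)

  -- The partner of the head lies in `xs`, which is a repetition, or in `ys`, and then both are
  -- struck out. The shorter `ys` runs out first.
  pigeonhole : ∀ xs {ys} → length ys < length xs → xs ∼ ys → Repeats xs
  pigeonhole (x ∷ xs) {ys} (s≤s l) p with Paired-uncons p
  ... | zs , q , r with Any.++⁻ xs (↭.∈-resp-↭ (↭-sym q) (here ≈.refl))
  ... | inj₁ x∈xs = here x∈xs
  ... | inj₂ x∈ys with extract x∈ys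
  ... | us , q′ = there (pigeonhole xs
    (ℕ.≤-trans (ℕ.≤-reflexive (sym (↭.xs↭ys⇒|xs|≡|ys| q′))) l)
    (Paired-resp (↭.drop-∷ (↭-trans (↭-sym q) (↭-trans (↭.++⁺ˡ xs q′) (↭.↭-shift xs us)))) r))

  -- By `shift` the stretch `x b y` equals `b y y`, so `x` and `y` can be struck out together.
  record Deletion (w : Word) : Set where
    constructor deletion
    field
      {a b c} : Word
      {x y}   : Fin n
      split   : w ≡ a ++ x ∷ b ++ y ∷ c
      shift   : (x ∷ b) ≈ (b ++ [ y ])

  Repeats⇒Deletion : ∀ w → Repeats (reflections w) → Deletion w
  Repeats⇒Deletion (x ∷ w) (here p) with reflection-split w (Any.map (conj-swap x) (Any.map⁻ p))
  ... | b , y , c , refl , q = deletion {a = []} refl (≈.trans (≈.sym (ss≈ x _)) q)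
  Repeats⇒Deletion (x ∷ w) (there p) with Repeats⇒Deletion w (Repeats-conj⁻ x p)
  ... | deletion {a = a} refl q = deletion {a = x ∷ a} refl q

  deletion-of-≈ : ∀ {w w′} → w ≈ w′ → length w′ < length w → Deletion w
  deletion-of-≈ {w} {w′} p l = Repeats⇒Deletion w
    (pigeonhole (reflections w) (subst₂ _<_ (sym (length-reflections w′)) (sym (length-reflections w)) l)
      (reflections-cong p))

-- Exactness of the Coxeter matrix

module IntegerRepresentation where
  open import Data.Integer using (ℤ; +_; -_; _+_; _-_; 0ℤ; 1ℤ)
  import Data.Integer.Properties as ℤ
  open import Data.Integer.Solver using (module +-*-Solver)

  Seq : Set
  Seq = ℕ → ℤ

  _⊕_ _⊖_ : Seq → Seq → Seq
  (F ⊕ G) x = F x + G x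
  (F ⊖ G) x = F x - G x

  ⊝_ : Seq → Seq
  (⊝ F) x = - F x

  𝟘 : Seq
  𝟘 _ = 0ℤ

  record Linear (a : Seq → Seq) : Set where
    field
      a-cong : ∀ {F G} → F ≗ G → a F ≗ a G
      a-⊖    : ∀ F G → a (F ⊖ G) ≗ (a F ⊖ a G)

    a-𝟘 : a 𝟘 ≗ 𝟘
    a-𝟘 x = trans (a-⊖ 𝟘 𝟘 x) (ℤ.+-inverseʳ (a 𝟘 x))

    a-⊝ : ∀ F → a (⊝ F) ≗ (⊝ a F)
    a-⊝ F x = trans (a-cong (λ y → sym (ℤ.+-identityˡ (- F y))) x)
      (trans (a-⊖ 𝟘 F x) (trans (cong (_- a F x) (a-𝟘 x)) (ℤ.+-identityˡ _)))

    a-⊕ : ∀ F G → a (F ⊕ G) ≗ (a F ⊕ a G)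
    a-⊕ F G x = trans (a-cong (λ y → cong (λ z → F y + z) (sym (ℤ.neg-involutive (G y)))) x)
      (trans (a-⊖ F (⊝ G) x)
        (cong (λ z → a F x + z) (trans (cong -_ (a-⊝ G x)) (ℤ.neg-involutive (a G x)))))

    -- The Chebyshev polynomial of the second kind U of degree r - 1, taken at a / 2; with 2 cos φ
    -- for the operator it is sin (r φ) / sin φ.
    cheb : ℕ → Seq → Seq
    cheb zero          F = 𝟘
    cheb (suc zero)    F = F
    cheb (suc (suc r)) F = a (cheb (suc r) F) ⊖ cheb r F

    cheb-a : ∀ r F → cheb r (a F) ≗ a (cheb r F)
    cheb-a zero          F x = sym (a-𝟘 x)
    cheb-a (suc zero)    F x = refl
    cheb-a (suc (suc r)) F x = trans
      (cong₂ _-_ (a-cong (cheb-a (suc r) F) x) (cheb-a r F x))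
      (sym (a-⊖ (a (cheb (suc r) F)) (cheb r F) x))

    cheb-𝟘 : ∀ r → cheb r 𝟘 ≗ 𝟘
    cheb-𝟘 zero x          = refl
    cheb-𝟘 (suc zero) x    = refl
    cheb-𝟘 (suc (suc r)) x =
      cong₂ _-_ (trans (a-cong (cheb-𝟘 (suc r)) x) (a-𝟘 x)) (cheb-𝟘 r x)

  gate : Bool → ℤ → ℤ
  gate true  z = z
  gate false z = 0ℤ

  gate-sub : ∀ b y z → gate b (y - z) ≡ gate b y - gate b z
  gate-sub true  y z = refl
  gate-sub false y z = refl

  -- The adjacency operator of the graph on ℕ with the edges x — x+1 for
  -- which edge x holds.
  module Path (edge : ℕ → Bool) where

    left : Seq → ℕ → ℤ
    left F zero    = 0ℤ
    left F (suc x) = gate (edge x) (F x)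

    adj : Seq → Seq
    adj F x = left F x + gate (edge x) (F (suc x))

    adj-linear : Linear adj
    adj-linear = record
      { a-cong = λ e x → cong₂ _+_ (left-cong e x) (cong (gate (edge x)) (e (suc x)))
      ; a-⊖    = λ F G x → trans
          (cong₂ _+_ (left-⊖ F G x) (gate-sub (edge x) (F (suc x)) (G (suc x))))
          (solve 4 (λ p q r s → (p :- q) :+ (r :- s) := (p :+ r) :- (q :+ s)) refl
            (left F x) (left G x) (gate (edge x) (F (suc x))) (gate (edge x) (G (suc x))))
      }
      where
      open +-*-Solver
      left-cong : ∀ {F G} → F ≗ G → left F ≗ left G
      left-cong e zero    = refl
      left-cong e (suc x) = cong (gate (edge x)) (e x)
      left-⊖ : ∀ F G x → left (F ⊖ G) x ≡ left F x - left G x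
      left-⊖ F G zero    = refl
      left-⊖ F G (suc x) = gate-sub (edge x) (F x) (G x)

    open Linear adj-linear public

    module Component (q : ℕ) (closed : ∀ F → left F q ≡ 0ℤ) where

      adj-start : ∀ F → adj F q ≡ gate (edge q) (F (suc q))
      adj-start F = trans (cong (_+ gate (edge q) (F (suc q))) (closed F)) (ℤ.+-identityˡ _)

      cheb-shift : ∀ r F x → cheb (suc (suc r)) F x ≡ cheb (suc r) (adj F) x - cheb r F x
      cheb-shift r F x = cong (_- cheb r F x) (sym (cheb-a (suc r) F x))

      adj-interior : ∀ F i → edge (q ℕ.+ i) ≡ true →
        adj F (q ℕ.+ suc i) ≡ F (q ℕ.+ i) + gate (edge (q ℕ.+ suc i)) (F (q ℕ.+ suc (suc i)))
      adj-interior F i e rewrite ℕ.+-suc q (suc i) | ℕ.+-suc q i | e = refl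

      -- At the free end of a path the recursion of `cheb` undoes the branching of the adjacency
      -- operator, so the polynomial of degree r carries the value at distance r to the end.
      cheb-start : ∀ r F → (∀ i → i < r → edge (q ℕ.+ i) ≡ true) → cheb (suc r) F q ≡ F (q ℕ.+ r)
      cheb-start zero F e = cong F (sym (ℕ.+-identityʳ q))
      cheb-start (suc zero) F e with e 0 (s≤s z≤n)
      ... | e₀ rewrite ℕ.+-identityʳ q | ℕ.+-comm q 1 =
        trans (ℤ.+-identityʳ _) (trans (adj-start F) (cong (λ b → gate b (F (suc q))) e₀))
      cheb-start (suc (suc r)) F e = begin
        cheb (suc (suc (suc r))) F q
          ≡⟨ cheb-shift (suc r) F q ⟩
        cheb (suc (suc r)) (adj F) q - cheb (suc r) F q
          ≡⟨ cong₂ _-_ (cheb-start (suc r) (adj F) (λ i l → e i (ℕ.m≤n⇒m≤1+n l)))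
                       (cheb-start r F (λ i l → e i (ℕ.m≤n⇒m≤1+n (ℕ.m≤n⇒m≤1+n l)))) ⟩
        adj F (q ℕ.+ suc r) - F (q ℕ.+ r)
          ≡⟨ cong (_- F (q ℕ.+ r)) (adj-interior F r (e r (ℕ.m≤n⇒m≤1+n ℕ.≤-refl))) ⟩
        F (q ℕ.+ r) + gate (edge (q ℕ.+ suc r)) (F (q ℕ.+ suc (suc r))) - F (q ℕ.+ r)
          ≡⟨ cong (λ b → F (q ℕ.+ r) + gate b (F (q ℕ.+ suc (suc r))) - F (q ℕ.+ r)) (e (suc r) ℕ.≤-refl) ⟩
        F (q ℕ.+ r) + F (q ℕ.+ suc (suc r)) - F (q ℕ.+ r)
          ≡⟨ solve 2 (λ y z → y :+ z :- y := z) refl (F (q ℕ.+ r)) _ ⟩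
        F (q ℕ.+ suc (suc r)) ∎
        where
        open ≡-Reasoning
        open +-*-Solver

      -- Here the degree equals the number r + 1 of vertices of the path, and the next vertex is cut
      -- off. This is its characteristic polynomial vanishing on the adjacency operator, seen at the
      -- end vertex.
      cheb-end : ∀ r F → (∀ i → i < r → edge (q ℕ.+ i) ≡ true) → edge (q ℕ.+ r) ≡ false →
                 cheb (suc (suc r)) F q ≡ 0ℤ
      cheb-end zero F e e₀ rewrite ℕ.+-identityʳ q =
        trans (ℤ.+-identityʳ _) (trans (adj-start F) (cong (λ b → gate b (F (suc q))) e₀))
      cheb-end (suc r) F e e₀ = begin
        cheb (suc (suc (suc r))) F q
          ≡⟨ cheb-shift (suc r) F q ⟩
        cheb (suc (suc r)) (adj F) q - cheb (suc r) F q
          ≡⟨ cong₂ _-_ (cheb-start (suc r) (adj F) e)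
                       (cheb-start r F (λ i l → e i (ℕ.m≤n⇒m≤1+n l))) ⟩
        adj F (q ℕ.+ suc r) - F (q ℕ.+ r)
          ≡⟨ cong (_- F (q ℕ.+ r)) (adj-interior F r (e r ℕ.≤-refl)) ⟩
        F (q ℕ.+ r) + gate (edge (q ℕ.+ suc r)) (F (q ℕ.+ suc (suc r))) - F (q ℕ.+ r)
          ≡⟨ cong (λ b → F (q ℕ.+ r) + gate b (F (q ℕ.+ suc (suc r))) - F (q ℕ.+ r)) e₀ ⟩
        F (q ℕ.+ r) + 0ℤ - F (q ℕ.+ r)
          ≡⟨ solve 1 (λ y → y :+ con 0ℤ :- y := con 0ℤ) refl (F (q ℕ.+ r)) ⟩
        0ℤ ∎
        where
        open ≡-Reasoning
        open +-*-Solver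

      -- If cheb k kills every sequence at q, then by adj ∘ cheb k = cheb k ∘ adj
      -- it kills the whole component of q.
      cheb-vanishes : ∀ k → (∀ F → cheb k F q ≡ 0ℤ) → ∀ r → (∀ i → i < r → edge (q ℕ.+ i) ≡ true) →
                      ∀ F → cheb k F (q ℕ.+ r) ≡ 0ℤ
      cheb-vanishes k z zero e F rewrite ℕ.+-identityʳ q = z F
      cheb-vanishes k z (suc zero) e F with e 0 (s≤s z≤n)
      ... | e₀ rewrite ℕ.+-identityʳ q | ℕ.+-comm q 1 = begin
        cheb k F (suc q)                 ≡⟨ cong (λ b → gate b (cheb k F (suc q))) e₀ ⟨
        gate (edge q) (cheb k F (suc q)) ≡⟨ adj-start (cheb k F) ⟨
        adj (cheb k F) q                 ≡⟨ cheb-a k F q ⟨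
        cheb k (adj F) q                 ≡⟨ z (adj F) ⟩
        0ℤ ∎
        where open ≡-Reasoning
      cheb-vanishes k z (suc (suc r)) e F = begin
        cheb k F (q ℕ.+ suc (suc r))
          ≡⟨ ℤ.+-identityˡ _ ⟨
        0ℤ + cheb k F (q ℕ.+ suc (suc r))
          ≡⟨ cong (_+ cheb k F (q ℕ.+ suc (suc r)))
               (cheb-vanishes k z r (λ i l → e i (ℕ.m≤n⇒m≤1+n (ℕ.m≤n⇒m≤1+n l))) F) ⟨
        cheb k F (q ℕ.+ r) + cheb k F (q ℕ.+ suc (suc r))
          ≡⟨ cong (λ b → cheb k F (q ℕ.+ r) + gate b (cheb k F (q ℕ.+ suc (suc r)))) (e (suc r) ℕ.≤-refl) ⟨
        cheb k F (q ℕ.+ r) + gate (edge (q ℕ.+ suc r)) (cheb k F (q ℕ.+ suc (suc r)))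
          ≡⟨ adj-interior (cheb k F) r (e r (ℕ.m≤n⇒m≤1+n ℕ.≤-refl)) ⟨
        adj (cheb k F) (q ℕ.+ suc r)
          ≡⟨ cheb-a k F (q ℕ.+ suc r) ⟨
        cheb k (adj F) (q ℕ.+ suc r)
          ≡⟨ cheb-vanishes k z (suc r) (λ i l → e i (ℕ.m≤n⇒m≤1+n l)) (adj F) ⟩
        0ℤ ∎
        where open ≡-Reasoning

  -- ℕ is cut into consecutive blocks of d vertices, each of them a path of
  -- type A_d.
  module Blocks (d′ : ℕ) where
    d : ℕ
    d = suc d′

    edge : ℕ → Bool
    edge x = not (does (d ∣? suc x))

    open Path edge public

    edge-inside : ∀ c i → suc i < d → edge (c ℕ.* d ℕ.+ i) ≡ true
    edge-inside c i l = cong not (dec-false (d ∣? suc (c ℕ.* d ℕ.+ i)) λ p →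
      ℕ.<⇒≱ l (∣⇒≤ (∣m+n∣m⇒∣n (subst (d ∣_) (sym (ℕ.+-suc (c ℕ.* d) i)) p) (n∣m*n c))))

    edge-end : ∀ c → edge (c ℕ.* d ℕ.+ d′) ≡ false
    edge-end c = cong not (dec-true (d ∣? suc (c ℕ.* d ℕ.+ d′))
      (subst (d ∣_) (ℕ.+-suc (c ℕ.* d) d′) (∣m∣n⇒∣m+n (n∣m*n c) ∣-refl)))

    closed : ∀ c F → left F (c ℕ.* d) ≡ 0ℤ
    closed zero    F = refl
    closed (suc c) F rewrite ℕ.+-comm d′ (c ℕ.* d) = cong (λ b → gate b (F (c ℕ.* d ℕ.+ d′))) (edge-end c)

    module Start (c : ℕ) = Component (c ℕ.* d) (closed c)

    cheb-d+1 : ∀ F → cheb (suc d) F ≗ 𝟘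
    cheb-d+1 F x = subst (λ y → cheb (suc d) F y ≡ 0ℤ) (sym x≡)
      (Start.cheb-vanishes (x / d) (suc d)
        (λ G → Start.cheb-end (x / d) d′ G (λ i l → edge-inside (x / d) i (s≤s l)) (edge-end (x / d)))
        (x % d) (λ i l → edge-inside (x / d) i (ℕ.≤-trans (s≤s l) (m%n<n x d))) F)
      where
      x≡ : x ≡ (x / d) ℕ.* d ℕ.+ x % d
      x≡ = trans (m≡m%n+[m/n]*n x d) (ℕ.+-comm (x % d) _)

    cheb-one : ∀ r → r < d → cheb (suc r) (λ _ → 1ℤ) 0 ≡ 1ℤ
    cheb-one r l = Start.cheb-start 0 r (λ _ → 1ℤ) (λ i l′ → edge-inside 0 i (ℕ.≤-trans (s≤s l′) l))

  -- The case of infinite order, where 2 cos (π / k) is replaced by its limit 2.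
  double : Seq → Seq
  double F = F ⊕ F

  double-linear : Linear double
  double-linear = record
    { a-cong = λ e x → cong₂ _+_ (e x) (e x)
    ; a-⊖    = λ F G x → solve 2 (λ p q → (p :- q) :+ (p :- q) := (p :+ p) :- (q :+ q)) refl (F x) (G x)
    }
    where open +-*-Solver

  cheb-double : ∀ r → Linear.cheb double-linear r (λ _ → 1ℤ) 0 ≡ + r
  cheb-double zero          = refl
  cheb-double (suc zero)    = refl
  cheb-double (suc (suc r)) rewrite cheb-double (suc r) | cheb-double r | ℤ.pos-+ 1 r | ℤ.pos-+ 2 r =
    solve 1 (λ p → (con 1ℤ :+ p) :+ (con 1ℤ :+ p) :- p := con (+ 2) :+ p) refl (+ r)
    where open +-*-Solver

  -- For m(s,t) = k the operator has Chebyshev polynomial U_k = 0, as has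
  -- 2 cos (π / k); the values at k ≤ 1 are irrelevant.
  bond : Maybe ℕ → Seq → Seq
  bond nothing              = double
  bond (just zero)          = λ _ → 𝟘
  bond (just (suc zero))    = λ _ → 𝟘
  bond (just (suc (suc d))) = Blocks.adj d

  bondLinear : ∀ k → Linear (bond k)
  bondLinear nothing              = double-linear
  bondLinear (just zero)          = record { a-cong = λ _ _ → refl ; a-⊖ = λ _ _ _ → refl }
  bondLinear (just (suc zero))    = record { a-cong = λ _ _ → refl ; a-⊖ = λ _ _ _ → refl }
  bondLinear (just (suc (suc d))) = Blocks.adj-linear d

  -- The sequences U_k x + U_{k-1} y and their sums with step two: the
  -- coordinates produced by alternately applying two reflections.
  module Dihedral {a : Seq → Seq} (a-linear : Linear a) (x y : Seq) where
    open Linear a-linear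
    open +-*-Solver

    walk : ℕ → Seq
    walk zero          = ⊝ y
    walk (suc zero)    = x
    walk (suc (suc r)) = a (walk (suc r)) ⊖ walk r

    walkSum : ℕ → Seq
    walkSum zero          = 𝟘
    walkSum (suc zero)    = 𝟘
    walkSum (suc (suc r)) = walk (suc r) ⊕ walkSum r

    chebSum : ℕ → Seq → Seq
    chebSum zero          F = 𝟘
    chebSum (suc zero)    F = 𝟘
    chebSum (suc (suc r)) F = cheb (suc r) F ⊕ chebSum r F

    walk-cheb : ∀ r → walk (suc r) ≗ (cheb (suc r) x ⊕ cheb r y)
    walk-cheb zero       e = sym (ℤ.+-identityʳ (x e))
    walk-cheb (suc zero) e =
      solve 3 (λ p q z → p :- (:- q) := (p :- con 0ℤ) :+ q) refl (a x e) (y e) 0ℤ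
    walk-cheb (suc (suc r)) e = trans
      (cong₂ _-_ (trans (a-cong (walk-cheb (suc r)) e) (a-⊕ (cheb (suc (suc r)) x) (cheb (suc r) y) e)) (walk-cheb r e))
      (solve 4 (λ p q r s → (p :+ q) :- (r :+ s) := (p :- r) :+ (q :- s)) refl
        (a (cheb (suc (suc r)) x) e) (a (cheb (suc r) y) e) (cheb (suc r) x e) (cheb r y e))

    walkSum-cheb : ∀ r → walkSum (suc r) ≗ (chebSum (suc r) x ⊕ chebSum r y)
    walkSum-cheb zero       e = refl
    walkSum-cheb (suc zero) e = sym (ℤ.+-identityʳ (x e + 0ℤ))
    walkSum-cheb (suc (suc r)) e = trans
      (cong₂ _+_ (walk-cheb (suc r) e) (walkSum-cheb r e))
      (solve 4 (λ p q r s → (p :+ q) :+ (r :+ s) := (p :+ r) :+ (q :+ s)) refl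
        (cheb (suc (suc r)) x e) (cheb (suc r) y e) (chebSum (suc r) x e) (chebSum r y e))

  module DihedralSymmetry {a : Seq → Seq} (a-linear : Linear a) (x y : Seq) (r : ℕ)
    (vanish : ∀ F → Linear.cheb a-linear (suc r) F ≗ 𝟘) where
    open Linear a-linear
    open +-*-Solver
    module XY = Dihedral a-linear x y
    module YX = Dihedral a-linear y x

    -- When `cheb (suc r)` vanishes, the next polynomial is the negative of the preceding one, and
    -- both sides reduce to minus `cheb r x`.
    walk-swap : XY.walk (suc (suc r)) ≗ (⊝ YX.walk (suc r))
    walk-swap e = begin
      XY.walk (suc (suc r)) e
        ≡⟨ XY.walk-cheb (suc r) e ⟩
      (a (cheb (suc r) x) e - cheb r x e) + cheb (suc r) y e
        ≡⟨ cong₂ (λ p q → (p - cheb r x e) + q) (trans (a-cong (vanish x) e) (a-𝟘 e)) (vanish y e) ⟩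
      (0ℤ - cheb r x e) + 0ℤ
        ≡⟨ solve 1 (λ p → (con 0ℤ :- p) :+ con 0ℤ := :- (con 0ℤ :+ p)) refl (cheb r x e) ⟩
      - (0ℤ + cheb r x e)
        ≡⟨ cong (λ p → - (p + cheb r x e)) (vanish y e) ⟨
      - (cheb (suc r) y e + cheb r x e)
        ≡⟨ cong -_ (YX.walk-cheb r e) ⟨
      - YX.walk (suc r) e ∎
      where open ≡-Reasoning

    walkSum-swap : XY.walkSum (suc (suc r)) ≗ YX.walkSum (suc r)
    walkSum-swap e = begin
      XY.walkSum (suc (suc r)) e
        ≡⟨ XY.walkSum-cheb (suc r) e ⟩
      (cheb (suc r) x e + XY.chebSum r x e) + XY.chebSum (suc r) y e
        ≡⟨ cong (λ p → (p + XY.chebSum r x e) + XY.chebSum (suc r) y e) (vanish x e) ⟩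
      (0ℤ + XY.chebSum r x e) + XY.chebSum (suc r) y e
        ≡⟨ solve 2 (λ p q → (con 0ℤ :+ p) :+ q := q :+ p) refl (XY.chebSum r x e) (XY.chebSum (suc r) y e) ⟩
      XY.chebSum (suc r) y e + XY.chebSum r x e
        ≡⟨ cong₂ _+_ (chebSum-≡ (suc r) y e) (chebSum-≡ r x e) ⟩
      YX.chebSum (suc r) y e + YX.chebSum r x e
        ≡⟨ YX.walkSum-cheb r e ⟨
      YX.walkSum (suc r) e ∎
      where
      open ≡-Reasoning
      -- The sum does not involve `x` and `y`, but its two instances are identified only by
      -- induction.
      chebSum-≡ : ∀ r F → XY.chebSum r F ≗ YX.chebSum r F
      chebSum-≡ zero          F e = refl
      chebSum-≡ (suc zero)    F e = refl
      chebSum-≡ (suc (suc r)) F e = cong (λ p → cheb (suc r) F e + p) (chebSum-≡ r F e)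

  -- The representation on vectors of integer sequences

  module Representation {n : ℕ} (M : CoxeterMatrix n) where
    open CoxeterGroup M

    Vector : Set
    Vector = Fin n → Seq

    _≐_ : Vector → Vector → Set
    f ≐ g = ∀ j → f j ≗ g j

    b : Fin n → Fin n → Seq → Seq
    b i j = bond (m i j)

    module Lin (i j : Fin n) = Linear (bondLinear (m i j))

    -- With `f j` read as the value of a linear form on the simple root of j, this is the
    -- contragredient geometric representation: the reflection of i sends the root of j to itself
    -- plus 2 cos (π / m) times the root of i, and `b i j` stands for that number.
    σ : Fin n → Vector → Vector
    σ i f j with i Fin.≟ j
    ... | yes _ = ⊝ f i
    ... | no  _ = f j ⊕ b i j (f i)

    σ-self : ∀ i f → σ i f i ≡ ⊝ f i
    σ-self i f with i Fin.≟ i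
    ... | yes _ = refl
    ... | no ¬p = contradiction refl ¬p

    σ-other : ∀ {i j} f → i ≢ j → σ i f j ≡ f j ⊕ b i j (f i)
    σ-other {i} {j} f i≢j with i Fin.≟ j
    ... | yes p = contradiction p i≢j
    ... | no  _ = refl

    σ-cong : ∀ i {f g} → f ≐ g → σ i f ≐ σ i g
    σ-cong i e j x with i Fin.≟ j
    ... | yes _ = cong -_ (e i x)
    ... | no  _ = cong₂ _+_ (e j x) (Lin.a-cong i j (e i) x)

    act : Word → Vector → Vector
    act []      f = f
    act (s ∷ w) f = σ s (act w f)

    act-++ : ∀ w w′ f → act (w ++ w′) f ≡ act w (act w′ f)
    act-++ []      w′ f = refl
    act-++ (s ∷ w) w′ f = cong (σ s) (act-++ w w′ f)

    act-ss : ∀ s f → σ s (σ s f) ≐ f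
    act-ss s f j x with s Fin.≟ j
    ... | yes refl = trans (cong (λ F → - F x) (σ-self s f)) (ℤ.neg-involutive (f s x))
    ... | no  s≢j  = begin
      σ s f j x + b s j (σ s f s) x
        ≡⟨ cong₂ (λ F G → F x + b s j G x) (σ-other f s≢j) (σ-self s f) ⟩
      f j x + b s j (f s) x + b s j (⊝ f s) x
        ≡⟨ cong (λ p → f j x + b s j (f s) x + p) (Lin.a-⊝ s j (f s) x) ⟩
      f j x + b s j (f s) x + - b s j (f s) x
        ≡⟨ solve 2 (λ p q → p :+ q :+ :- q := p) refl (f j x) _ ⟩
      f j x ∎
      where
      open ≡-Reasoning
      open +-*-Solver

    -- The last letter of alt s t k, which acts first; first t s k is the other
    -- letter.
    first : Fin n → Fin n → ℕ → Fin n
    first s t zero    = t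
    first s t (suc k) = first t s k

    module Alternating (f : Vector) where

      -- Only the coordinates at `s` and `t` feed back, through the single operator of `l`; this
      -- gives the walk. Any other coordinate merely accumulates images of the walk under `b s j`
      -- and `b t j`, which is why operators never have to commute. The variable `l` lets m(s,t) and
      -- m(t,s) share one operator.
      act-alt : ∀ s t k (l : Maybe ℕ) → m s t ≡ l → m t s ≡ l → s ≢ t →
        let open Dihedral (bondLinear l) (f (first s t k)) (f (first t s k)) in
        act (alt s t k) f s ≗ (⊝ walk k) ×
        act (alt s t k) f t ≗ walk (suc k) ×
        (∀ j → s ≢ j → t ≢ j → act (alt s t k) f j ≗ (f j ⊕ (b s j (walkSum (suc k)) ⊕ b t j (walkSum k))))
      act-alt s t zero l _ _ s≢t =
        (λ x → sym (ℤ.neg-involutive (f s x))) , (λ _ → refl) ,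
        λ j _ _ x → sym (trans (cong (λ p → f j x + p) (cong₂ _+_ (Lin.a-𝟘 s j x) (Lin.a-𝟘 t j x))) (ℤ.+-identityʳ (f j x)))
      act-alt s t (suc k) l e e′ s≢t with act-alt t s k l e′ e (s≢t ∘ sym)
      ... | pt , ps , pj = at-s , at-t , at-j
        where
        open Dihedral (bondLinear l) (f (first t s k)) (f (first s t k))
        open ≡-Reasoning
        open +-*-Solver
        g = act (alt t s k) f
        at-s : σ s g s ≗ (⊝ walk (suc k))
        at-s x = trans (cong (λ F → F x) (σ-self s g)) (cong -_ (ps x))
        at-t : σ s g t ≗ walk (suc (suc k))
        at-t x = begin
          σ s g t x                    ≡⟨ cong (λ F → F x) (σ-other g s≢t) ⟩
          g t x + b s t (g s) x        ≡⟨ cong₂ _+_ (pt x) (Lin.a-cong s t ps x) ⟩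
          - walk k x + b s t (walk (suc k)) x ≡⟨ cong (λ l → - walk k x + bond l (walk (suc k)) x) e ⟩
          - walk k x + bond l (walk (suc k)) x  ≡⟨ ℤ.+-comm (- walk k x) _ ⟩
          walk (suc (suc k)) x         ∎
        at-j : ∀ j → s ≢ j → t ≢ j →
          σ s g j ≗ (f j ⊕ (b s j (walkSum (suc (suc k))) ⊕ b t j (walkSum (suc k))))
        at-j j s≢j t≢j x = begin
          σ s g j x
            ≡⟨ cong (λ F → F x) (σ-other g s≢j) ⟩
          g j x + b s j (g s) x
            ≡⟨ cong₂ _+_ (pj j t≢j s≢j x) (Lin.a-cong s j ps x) ⟩
          f j x + (b t j (walkSum (suc k)) x + b s j (walkSum k) x) + b s j (walk (suc k)) x
            ≡⟨ solve 4 (λ p q r u → p :+ (q :+ r) :+ u := p :+ ((u :+ r) :+ q)) refl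
                 (f j x) (b t j (walkSum (suc k)) x) (b s j (walkSum k) x) (b s j (walk (suc k)) x) ⟩
          f j x + ((b s j (walk (suc k)) x + b s j (walkSum k) x) + b t j (walkSum (suc k)) x)
            ≡⟨ cong (λ p → f j x + (p + b t j (walkSum (suc k)) x)) (Lin.a-⊕ s j (walk (suc k)) (walkSum k) x) ⟨
          f j x + (b s j (walkSum (suc (suc k))) x + b t j (walkSum (suc k)) x) ∎

    act-braid : ∀ s t k → m s t ≡ just k → ∀ f → act (alt s t k) f ≐ act (alt t s k) f
    act-braid s t k e f with s Fin.≟ t
    ... | yes refl = λ _ _ → refl
    ... | no  s≢t with offdiag s t s≢t k e
    act-braid s t (suc (suc d)) e f | no s≢t | s≤s (s≤s _)
      with Alternating.act-alt f s t k′ (just k′) e (trans (symm t s) e) s≢t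
         | Alternating.act-alt f t s k′ (just k′) (trans (symm t s) e) e (s≢t ∘ sym)
      where k′ = suc (suc d)
    ... | ps , pt , pj | qt , qs , qj = λ j → same j (s Fin.≟ j) (t Fin.≟ j)
      where
      k = suc (suc d)
      module S = DihedralSymmetry (bondLinear (just k)) (f (first s t k)) (f (first t s k)) (suc d) (Blocks.cheb-d+1 d)
      module T = DihedralSymmetry (bondLinear (just k)) (f (first t s k)) (f (first s t k)) (suc d) (Blocks.cheb-d+1 d)
      same : ∀ j → Dec (s ≡ j) → Dec (t ≡ j) → act (alt s t k) f j ≗ act (alt t s k) f j
      same j (yes refl) _          x = trans (ps x) (sym (trans (qs x) (T.walk-swap x)))
      same j (no _)     (yes refl) x = trans (pt x) (trans (S.walk-swap x) (sym (qt x)))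
      same j (no s≢j)   (no t≢j)   x = trans (pj j s≢j t≢j x) (trans
        (cong (λ p → f j x + p) (trans
          (cong₂ _+_ (Lin.a-cong s j S.walkSum-swap x) (Lin.a-cong t j (λ x → sym (T.walkSum-swap x)) x))
          (ℤ.+-comm (b s j _ x) (b t j _ x))))
        (sym (qj j t≢j s≢j x)))

    act-step : ∀ {w w′} → Step w w′ → ∀ f → act w f ≐ act w′ f
    act-step (cancel (x ∷ xs) ys s) f = σ-cong x (act-step (cancel xs ys s) f)
    act-step (cancel [] ys s) f = act-ss s (act ys f)
    act-step (braid (x ∷ xs) ys s t k e) f = σ-cong x (act-step (braid xs ys s t k e) f)
    act-step (braid [] ys s t k e) f rewrite act-++ (alt s t k) ys f | act-++ (alt t s k) ys f =
      act-braid s t k e (act ys f)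

    act-≈ : ∀ {w w′} → w ≈ w′ → ∀ f → act w f ≐ act w′ f
    act-≈ p f = EqC.gfold ≐-equiv (λ w → act w f) (λ s → act-step s f) p
      where
      ≐-equiv : IsEquivalence _≐_
      ≐-equiv = record
        { refl  = λ _ _ → refl
        ; sym   = λ e j x → sym (e j x)
        ; trans = λ e e′ j x → trans (e j x) (e′ j x)
        }

    BelowOrder : ℕ → Maybe ℕ → Set
    BelowOrder i l = ∀ k → l ≡ just k → i < k

    cheb-nonzero : ∀ r l → BelowOrder (suc r) l → (∀ k → l ≡ just k → 2 ≤ k) →
                   let z = Linear.cheb (bondLinear l) (suc r) (λ _ → 1ℤ) 0 in ¬ (- z ≡ z)
    cheb-nonzero r nothing b _ e rewrite cheb-double (suc r) with () ← e
    cheb-nonzero r (just k) b 2≤k e with 2≤k k refl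
    cheb-nonzero r (just (suc (suc d))) b 2≤k e | s≤s (s≤s _)
      rewrite Blocks.cheb-one d r (ℕ.≤-pred (b (suc (suc d)) refl)) with () ← e

    first-≢ : ∀ {s t} k → s ≢ t → first s t k ≢ first t s k
    first-≢ zero    s≢t = s≢t ∘ sym
    first-≢ (suc k) s≢t = first-≢ k (s≢t ∘ sym)

    -- The vector that is 1 at the last letter of `alt s t (suc r)` and 0 elsewhere separates the
    -- two words: their coordinates at `s` are - z and z, where z is 1 for finite order and `suc r`
    -- for infinite order.
    alt-≉ : ∀ {s t} r → s ≢ t → BelowOrder (suc r) (m s t) → ¬ (alt s t (suc r) ≈ alt t s (suc r))
    alt-≉ {s} {t} r s≢t below p = cheb-nonzero r (m s t) below (offdiag s t s≢t) (begin
      - z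
        ≡⟨ cong -_ (trans (WZ.walk-cheb r 0) (trans (cong₂ _+_ (cong at₀ f-u) (cong at₁ f-v))
             (trans (cong (λ q → z + q) (cheb-𝟘 r 0)) (ℤ.+-identityʳ z)))) ⟨
      - WZ.walk (suc r) 0
        ≡⟨ proj₁ (Alternating.act-alt f s t (suc r) (m s t) refl (symm t s) s≢t) 0 ⟨
      act (alt s t (suc r)) f s 0
        ≡⟨ act-≈ p f s 0 ⟩
      act (alt t s (suc r)) f s 0
        ≡⟨ proj₁ (proj₂ (Alternating.act-alt f t s (suc r) (m s t) (symm t s) refl (s≢t ∘ sym))) 0 ⟩
      ZW.walk (suc (suc r)) 0
        ≡⟨ trans (ZW.walk-cheb (suc r) 0) (trans (cong₂ _+_ (cong at₂ f-v) (cong at₀ f-u))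
             (trans (cong (λ q → q + z) (cheb-𝟘 (suc (suc r)) 0)) (ℤ.+-identityˡ z))) ⟩
      z ∎)
      where
      open ≡-Reasoning
      open Linear (bondLinear (m s t))
      𝟙 : Seq
      𝟙 _ = 1ℤ
      z : ℤ
      z = cheb (suc r) 𝟙 0
      at₀ at₁ at₂ : Seq → ℤ
      at₀ F = cheb (suc r) F 0
      at₁ F = cheb r F 0
      at₂ F = cheb (suc (suc r)) F 0
      u = first s t (suc r)
      v = first t s (suc r)
      f : Vector
      f j with u Fin.≟ j
      ... | yes _ = 𝟙
      ... | no  _ = 𝟘
      f-u : f u ≡ 𝟙
      f-u with u Fin.≟ u
      ... | yes _ = refl
      ... | no ¬e = contradiction refl ¬e
      f-v : f v ≡ 𝟘
      f-v with u Fin.≟ v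
      ... | yes e = contradiction e (first-≢ (suc r) s≢t)
      ... | no  _ = refl
      module WZ = Dihedral (bondLinear (m s t)) (f u) (f v)
      module ZW = Dihedral (bondLinear (m s t)) (f v) (f u)

-- The word problem

module WordProblem {n : ℕ} (M : CoxeterMatrix n) where
  open import Data.Nat using (_+_)
  open CoxeterGroup M
  open IntegerRepresentation.Representation M using (alt-≉; BelowOrder)

  length-snoc : ∀ (w : Word) s → length (w ++ [ s ]) ≡ suc (length w)
  length-snoc w s = trans (List.length-++ w) (ℕ.+-comm (length w) 1)

  snoc-assoc : ∀ (x y : Word) s → (x ++ y) ++ [ s ] ≡ x ++ y ++ [ s ]
  snoc-assoc x y s = List.++-assoc x y [ s ]

  shorten : ∀ {w} → Deletion w → ∃ λ w′ → w′ ≈ w × length w′ < length w × Sublist _≡_ w′ w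
  shorten (deletion {a} {b} {c} {x} {y} refl p) = a ++ b ++ c , ≈.sym eq , shorter , sub
    where
    eq : (a ++ x ∷ b ++ y ∷ c) ≈ (a ++ b ++ c)
    eq = ++-congˡ a (begin
      (x ∷ b) ++ y ∷ c          ≈⟨ ++-congʳ (y ∷ c) p ⟩
      (b ++ [ y ]) ++ y ∷ c     ≈⟨ assoc b [ y ] (y ∷ c) ⟩
      b ++ y ∷ y ∷ c            ≈⟨ ++-congˡ b (ss≈ y c) ⟩
      b ++ c                    ∎)
      where open ≈-Reasoning
    sub : Sublist _≡_ (a ++ b ++ c) (a ++ x ∷ b ++ y ∷ c)
    sub = Sub.++⁺ (Sub.refl refl {a}) (x ∷ʳ Sub.++⁺ (Sub.refl refl {b}) (y ∷ʳ Sub.refl refl))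
    shorter : length (a ++ b ++ c) < length (a ++ x ∷ b ++ y ∷ c)
    shorter rewrite List.length-++ a {b ++ c} | List.length-++ a {x ∷ b ++ y ∷ c}
                  | List.length-++ b {c} | List.length-++ b {y ∷ c} =
      ℕ.+-monoʳ-< (length a) (s≤s (ℕ.+-monoʳ-≤ (length b) (ℕ.n≤1+n (length c))))

  Reduced⇒¬Deletion : ∀ {w} → Reduced w → ¬ Deletion w
  Reduced⇒¬Deletion red d with shorten d
  ... | w′ , p , l , _ = ℕ.<⇒≱ l (red w′ p)

  ¬Deletion⇒Reduced : ∀ {w} → ¬ Deletion w → Reduced w
  ¬Deletion⇒Reduced ¬d w′ p = ℕ.≮⇒≥ λ l → ¬d (deletion-of-≈ (≈.sym p) l)

  Reduced-++ˡ : ∀ x {y} → Reduced (x ++ y) → Reduced x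
  Reduced-++ˡ x {y} red x′ p = ℕ.+-cancelʳ-≤ (length y) _ _
    (subst₂ _≤_ (List.length-++ x) (List.length-++ x′) (red (x′ ++ y) (++-congʳ y p)))

  Reduced-++ʳ : ∀ x {y} → Reduced (x ++ y) → Reduced y
  Reduced-++ʳ x {y} red y′ p = ℕ.+-cancelˡ-≤ (length x) _ _
    (subst₂ _≤_ (List.length-++ x) (List.length-++ x) (red (x ++ y′) (++-congˡ x p)))

  Reduced-resp : ∀ {r r′} → Reduced r → r′ ≈ r → length r′ ≡ length r → Reduced r′
  Reduced-resp red p e w q = ℕ.≤-trans (ℕ.≤-reflexive e) (red w (≈.trans q p))

  Reduced-length : ∀ {r r′} → Reduced r → Reduced r′ → r ≈ r′ → length r ≡ length r′
  Reduced-length red red′ p = ℕ.≤-antisym (red _ (≈.sym p)) (red′ _ p)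

  Reduced-inv : ∀ {r} → Reduced r → Reduced (inv r)
  Reduced-inv {r} red w p = subst₂ _≤_ (sym (List.length-reverse r)) (List.length-reverse w)
    (red (inv w) (≈.trans (inv-cong p) (≈.reflexive (inv-inv r))))

  -- Reduced alternating words

  AtMostOrder : ℕ → Maybe ℕ → Set
  AtMostOrder i l = ∀ k → l ≡ just k → i ≤ k

  length-alt : ∀ s t k → length (alt s t k) ≡ k
  length-alt s t zero    = refl
  length-alt s t (suc k) = cong suc (length-alt t s k)

  alt-prefix : ∀ s t i w {c} → w ++ c ≡ alt s t i → w ≡ alt s t (length w)
  alt-prefix s t i       []      e = refl
  alt-prefix s t (suc i) (x ∷ w) e with List.∷-injective e
  ... | refl , e′ = cong (s ∷_) (alt-prefix t s i w e′)

  -- Inside an alternating word `x b` and `b y` are alternating words of the same length with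
  -- different first letters. Since `x b y` still fits, that length is below m(s,t), and `alt-≉`
  -- keeps them apart.
  alt-¬Deletion : ∀ {s t} i → s ≢ t → AtMostOrder i (m s t) → ¬ Deletion (alt s t i)
  alt-¬Deletion {s} {t} i s≢t l (deletion {[]} {b} {c} {x} {y} e p)
    with alt-prefix s t i (x ∷ b ++ [ y ]) {c} (trans (cong (x ∷_) (List.++-assoc b [ y ] c)) (sym e))
  ... | e′ with List.∷-injective e′
  ... | refl , e″ = alt-≉ (length b) s≢t below (begin
      alt s t (suc (length b)) ≡⟨ alt-prefix s t i (s ∷ b) (sym e) ⟨
      s ∷ b                    ≈⟨ p ⟩
      b ++ [ y ]               ≡⟨ e″ ⟩
      alt t s (length (b ++ [ y ])) ≡⟨ cong (alt t s) (length-snoc b y) ⟩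
      alt t s (suc (length b)) ∎)
    where
    open ≈-Reasoning
    below : BelowOrder (suc (length b)) (m s t)
    below k q = ℕ.≤-trans (ℕ.≤-trans len (ℕ.≤-reflexive (trans (sym (cong length e)) (length-alt s t i)))) (l k q)
      where
      len : suc (suc (length b)) ≤ length (s ∷ b ++ y ∷ c)
      len rewrite List.length-++ b {y ∷ c} | ℕ.+-suc (length b) (length c) = s≤s (s≤s (ℕ.m≤m+n _ _))
  alt-¬Deletion {s} {t} (suc i) s≢t l (deletion {z ∷ a} {b} e p) =
    alt-¬Deletion i (s≢t ∘ sym) (λ k q → ℕ.≤-trans (ℕ.n≤1+n i) (l k (trans (symm s t) q)))
      (deletion {a = a} {b = b} (List.∷-injectiveʳ e) p)

  -- Indexed by the last letter instead of the first, because descents are taken on the right.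
  altR : Fin n → Fin n → ℕ → Word
  altR s t k = inv (alt s t k)

  altR-suc : ∀ s t k → altR s t (suc k) ≡ altR t s k ++ [ s ]
  altR-suc s t k = inv-∷ s (alt t s k)

  length-altR : ∀ s t k → length (altR s t k) ≡ k
  length-altR s t k = trans (List.length-reverse (alt s t k)) (length-alt s t k)

  altR-braid : ∀ {s t k} → m s t ≡ just k → altR s t k ≈ altR t s k
  altR-braid e = inv-cong (alt-braid e)

  altR-Reduced : ∀ {s t} i → s ≢ t → AtMostOrder i (m s t) → Reduced (altR s t i)
  altR-Reduced i s≢t l = Reduced-inv (¬Deletion⇒Reduced (alt-¬Deletion i s≢t l))

  -- Phrased with lengths of words, because `ℓ` is defined only after this relation has been
  -- decided. For a reduced `w` it is the usual right descent.
  Descent : Word → Fin n → Set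
  Descent w s = ∃ λ x → w ≈ (x ++ [ s ]) × length w ≡ suc (length x)

  Descent-resp : ∀ {w w′ s} → w ≈ w′ → length w ≡ length w′ → Descent w s → Descent w′ s
  Descent-resp p e (x , q , e′) = x , ≈.trans (≈.sym p) q , trans (sym e) e′

  Descent-Reduced : ∀ {w s} → Reduced w → ((x , _) : Descent w s) → Reduced (x ++ [ s ])
  Descent-Reduced {s = s} red (x , p , e) = Reduced-resp red (≈.sym p) (trans (length-snoc x s) (sym e))

  record Exchange (w : Word) (s : Fin n) : Set where
    constructor exchange
    field
      {a b} : Word
      {x}   : Fin n
      split : w ≡ a ++ x ∷ b
      shift : (x ∷ b) ≈ (b ++ [ s ])

  Deletion-snoc : ∀ w s → Deletion (w ++ [ s ]) → Deletion w ⊎ Exchange w s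
  Deletion-snoc w s (deletion {a} {b} {c} {x} {y} e p) with initLast c
  ... | [] with List.∷ʳ-injective w (a ++ x ∷ b) (trans e (sym (snoc-assoc a (x ∷ b) y)))
  ...   | e′ , refl = inj₂ (exchange {a = a} {b} e′ p)
  Deletion-snoc w s (deletion {a} {b} {x = x} {y} e p) | c ∷ʳ′ z =
    inj₁ (deletion {a = a} {b} {c} (proj₁ (List.∷ʳ-injective w (a ++ x ∷ b ++ y ∷ c)
      (trans e (trans (cong (λ - → a ++ x ∷ -) (sym (List.++-assoc b (y ∷ c) [ z ])))
        (sym (List.++-assoc a (x ∷ b ++ y ∷ c) [ z ])))))) p)

  Descent⇒Exchange : ∀ {w s} → Reduced w → Descent w s → Exchange w s
  Descent⇒Exchange {w} {s} red (x , p , e)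
    with Deletion-snoc w s (deletion-of-≈ (snoc-swap p)
      (ℕ.≤-trans (ℕ.≤-reflexive (sym e)) (ℕ.≤-trans (ℕ.n≤1+n _) (ℕ.≤-reflexive (sym (length-snoc w s))))))
  ... | inj₁ d = contradiction d (Reduced⇒¬Deletion red)
  ... | inj₂ ex = ex

  length-remove : ∀ (a : Word) x b → length (a ++ x ∷ b) ≡ suc (length (a ++ b))
  length-remove []      x b = refl
  length-remove (_ ∷ a) x b = cong suc (length-remove a x b)

  Exchange⇒Descent : ∀ {w s} → Exchange w s → Descent w s
  Exchange⇒Descent {s = s} (exchange {a} {b} {x} refl p) =
    a ++ b , ≈.trans (++-congˡ a p) (≈.reflexive (sym (snoc-assoc a b s))) , length-remove a x b

  ¬Descent⇒Reduced : ∀ {w s} → Reduced w → ¬ Descent w s → Reduced (w ++ [ s ])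
  ¬Descent⇒Reduced {w} {s} red ¬d = ¬Deletion⇒Reduced λ d →
    Sum.[ Reduced⇒¬Deletion red , ¬d ∘ Exchange⇒Descent ] (Deletion-snoc w s d)

  ++-split : ∀ (z : Word) {A} a {x b} → z ++ A ≡ a ++ x ∷ b →
    (∃ λ a′ → a ≡ z ++ a′ × A ≡ a′ ++ x ∷ b) ⊎ (∃ λ b′ → z ≡ a ++ x ∷ b′ × b ≡ b′ ++ A)
  ++-split []      a       e = inj₁ (a , refl , e)
  ++-split (y ∷ z) []      e with List.∷-injective e
  ... | refl , e′ = inj₂ (z , refl , sym e′)
  ++-split (y ∷ z) (_ ∷ a) e with List.∷-injective e
  ... | refl , e′ with ++-split z a e′
  ...   | inj₁ (a′ , refl , q) = inj₁ (a′ , refl , q)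
  ...   | inj₂ (b′ , refl , q) = inj₂ (b′ , refl , q)

  -- Alternating endings and the decision of descents

  EndsInAlt : Word → Fin n → Fin n → ℕ → Set
  EndsInAlt w s t k = ∃ λ z → w ≈ (z ++ altR s t k) × length w ≡ length z + k

  EndsInBraid : Word → Fin n → Fin n → Set
  EndsInBraid w s t = ∃ λ k → m s t ≡ just k × EndsInAlt w s t k

  EndsInAlt-braid : ∀ {w s t k} → m s t ≡ just k → EndsInAlt w s t k → EndsInAlt w t s k
  EndsInAlt-braid e (z , p , l) = z , ≈.trans p (++-congˡ z (altR-braid e)) , l

  EndsInAlt-Descent : ∀ {w s t k} → EndsInAlt w s t (suc k) → Descent w s
  EndsInAlt-Descent {w} {s} {t} {k} (z , p , l) =
    z ++ altR t s k ,
    ≈.trans p (≈.reflexive (trans (cong (z ++_) (altR-suc s t k)) (sym (snoc-assoc z (altR t s k) s)))) ,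
    trans l (trans (ℕ.+-suc (length z) k) (cong suc (sym (trans (List.length-++ z) (cong (length z +_) (length-altR t s k))))))

  Descent-EndsInAlt : ∀ {w s} t → Descent w s → EndsInAlt w s t 1
  Descent-EndsInAlt t (x , p , l) = x , p , trans l (ℕ.+-comm 1 (length x))

  -- Exchange for `t` takes a letter from the alternating tail, which would shorten the reduced word
  -- `altR t s (suc j)`, or from `z`, and then `t` extends the tail.
  lengthen : ∀ {w s t j} → Reduced w → s ≢ t → Descent w t → AtMostOrder (suc j) (m s t) →
             ((z , _) : EndsInAlt w s t j) → ∃ λ ((z′ , _) : EndsInAlt w t s (suc j)) → length z ≡ suc (length z′)
  lengthen {w} {s} {t} {j} red s≢t d l (z , p , len)
    with Descent⇒Exchange v-red (Descent-resp p same-length d)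
    where
    same-length : length w ≡ length (z ++ altR s t j)
    same-length = trans len (sym (trans (List.length-++ z) (cong (length z +_) (length-altR s t j))))
    v-red : Reduced (z ++ altR s t j)
    v-red = Reduced-resp red (≈.sym p) (sym same-length)
  ... | exchange {a} {b} {x} split shift with ++-split z a split
  ... | inj₁ (a′ , _ , e) = contradiction
    (altR-Reduced (suc j) (s≢t ∘ sym) (λ k q → l k (trans (symm s t) q)) (a′ ++ b) (≈.sym (begin
      altR t s (suc j)       ≡⟨ altR-suc t s j ⟩
      altR s t j ++ [ t ]    ≈⟨ snoc-swap eq ⟩
      a′ ++ b                ∎)))
    (ℕ.<⇒≱ (subst (length (a′ ++ b) <_) (sym (length-altR t s (suc j)))
      (s≤s (ℕ.≤-trans (ℕ.n≤1+n _) (ℕ.≤-reflexive (trans (sym (length-remove a′ x b)) (trans (sym (cong length e)) (length-altR s t j))))))))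
    where
    open ≈-Reasoning
    eq : altR s t j ≈ ((a′ ++ b) ++ [ t ])
    eq = begin
      altR s t j          ≡⟨ e ⟩
      a′ ++ x ∷ b         ≈⟨ ++-congˡ a′ shift ⟩
      a′ ++ b ++ [ t ]    ≡⟨ snoc-assoc a′ b t ⟨
      (a′ ++ b) ++ [ t ]  ∎
  ... | inj₂ (b′ , refl , refl) =
    (a ++ b′ , (begin
      w                                     ≈⟨ p ⟩
      (a ++ x ∷ b′) ++ altR s t j           ≡⟨ List.++-assoc a (x ∷ b′) (altR s t j) ⟩
      a ++ x ∷ b′ ++ altR s t j             ≈⟨ ++-congˡ a shift ⟩
      a ++ (b′ ++ altR s t j) ++ [ t ]      ≡⟨ cong (a ++_) (snoc-assoc b′ (altR s t j) t) ⟩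
      a ++ b′ ++ altR s t j ++ [ t ]        ≡⟨ List.++-assoc a b′ (altR s t j ++ [ t ]) ⟨
      (a ++ b′) ++ altR s t j ++ [ t ]      ≡⟨ cong ((a ++ b′) ++_) (altR-suc t s j) ⟨
      (a ++ b′) ++ altR t s (suc j)         ∎)
    , trans len (trans (cong (_+ j) (length-remove a x b′)) (sym (ℕ.+-suc (length (a ++ b′)) j))))
    , length-remove a x b′
    where open ≈-Reasoning

  -- The tail is lengthened by the two letters in turn until its length is m(s,t). The prefix loses
  -- a letter each time, which supplies the fuel `N` and rules out infinite order.
  two-descents : ∀ {w s t} → Reduced w → s ≢ t → Descent w s → Descent w t → EndsInBraid w s t
  two-descents {w} {s} {t} red s≢t ds dt =
    go (length (proj₁ ds)) 1 s≢t ds dt (Descent-EndsInAlt t ds) ℕ.≤-refl (λ k e → ℕ.≤-trans (s≤s z≤n) (offdiag s t s≢t k e))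
    where
    go : ∀ N {s t} j → s ≢ t → Descent w s → Descent w t → ((z , _) : EndsInAlt w s t j) → length z ≤ N →
         AtMostOrder j (m s t) → EndsInBraid w s t
    next : ∀ N {s t} j → s ≢ t → Descent w s → Descent w t → ((z , _) : EndsInAlt w s t j) → length z ≤ N →
           AtMostOrder (suc j) (m s t) → EndsInBraid w s t
    next N {s} {t} j s≢t ds dt z l b with lengthen red s≢t dt b z
    next zero    j s≢t ds dt z l b | z′ , e with () ← ℕ.≤-trans (ℕ.≤-reflexive (sym e)) l
    next (suc N) {s} {t} j s≢t ds dt z l b | z′ , e
      with go N (suc j) (s≢t ∘ sym) dt ds z′ (ℕ.≤-pred (ℕ.≤-trans (ℕ.≤-reflexive (sym e)) l))
              (λ k q → b k (trans (symm s t) q))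
    ... | k , q , ends = k , trans (symm s t) q , EndsInAlt-braid q ends
    go N {s} {t} j s≢t ds dt z l b = cases (m s t) refl
      where
      cases : ∀ o → m s t ≡ o → EndsInBraid w s t
      cases nothing e = next N j s≢t ds dt z l λ k q → contradiction (trans (sym e) q) λ ()
      cases (just k) e with j ℕ.≟ k
      ... | yes refl = k , e , z
      ... | no  j≢k  = next N j s≢t ds dt z l λ k′ q → ℕ.≤∧≢⇒< (b k′ q) λ j≡k′ → j≢k (trans j≡k′ (just-injective (trans (sym q) e)))

  EndsInAlt-dec : ∀ N → (∀ w → length w ≤ N → Reduced w → ∀ t → Dec (Descent w t)) →
    ∀ j s t w → length w ≤ N → Reduced w → Dec (EndsInAlt w s t j)
  EndsInAlt-dec N dec zero    s t w l red = yes (w , ≈.sym (++-[] w) , sym (ℕ.+-identityʳ (length w)))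
  EndsInAlt-dec N dec (suc j) s t w l red with dec w l red s
  ... | no ¬d = no (¬d ∘ EndsInAlt-Descent)
  ... | yes d@(x , p , e) = map′ to from
    (EndsInAlt-dec N dec j t s x (ℕ.≤-trans (ℕ.n≤1+n _) (ℕ.≤-trans (ℕ.≤-reflexive (sym e)) l))
      (Reduced-++ˡ x (Descent-Reduced red d)))
    where
    to : EndsInAlt x t s j → EndsInAlt w s t (suc j)
    to (z , q , e′) = z , (begin
      w                              ≈⟨ p ⟩
      x ++ [ s ]                     ≈⟨ ++-congʳ [ s ] q ⟩
      (z ++ altR t s j) ++ [ s ]     ≡⟨ snoc-assoc z (altR t s j) s ⟩
      z ++ altR t s j ++ [ s ]       ≡⟨ cong (z ++_) (altR-suc s t j) ⟨
      z ++ altR s t (suc j)          ∎) , trans e (trans (cong suc e′) (sym (ℕ.+-suc (length z) j)))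
      where open ≈-Reasoning
    from : EndsInAlt w s t (suc j) → EndsInAlt x t s j
    from (z , q , e′) = z , cancelʳ [ s ] (begin
      x ++ [ s ]                     ≈⟨ p ⟨
      w                              ≈⟨ q ⟩
      z ++ altR s t (suc j)          ≡⟨ cong (z ++_) (altR-suc s t j) ⟩
      z ++ altR t s j ++ [ s ]       ≡⟨ snoc-assoc z (altR t s j) s ⟨
      (z ++ altR t s j) ++ [ s ]     ∎) , ℕ.suc-injective (trans (sym e) (trans e′ (ℕ.+-suc (length z) j)))
      where open ≈-Reasoning

  -- For a word ending in `s`, a different letter `t` is a descent exactly if the word ends in the
  -- braid word of `s` and `t`. Without the final `s` this becomes a question about a shorter word.
  Descent-dec : ∀ N w → length w ≤ N → Reduced w → ∀ t → Dec (Descent w t)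
  Descent-dec N w l red t with initLast w
  Descent-dec N .[] l red t | [] = no λ ()
  Descent-dec zero .(x ++ [ s ]) l red t | x ∷ʳ′ s with () ← ℕ.≤-trans (ℕ.≤-reflexive (sym (length-snoc x s))) l
  Descent-dec (suc N) .(x ++ [ s ]) l red t | x ∷ʳ′ s with s Fin.≟ t
  ... | yes refl = yes (x , ≈.refl , length-snoc x s)
  ... | no  s≢t  = cases (m s t) refl
    where
    ds : Descent (x ++ [ s ]) s
    ds = x , ≈.refl , length-snoc x s
    cases : ∀ o → m s t ≡ o → Dec (Descent (x ++ [ s ]) t)
    cases nothing e = no λ dt → contradiction (trans (sym e) (proj₁ (proj₂ (two-descents red s≢t ds dt)))) λ ()
    cases (just zero) e with () ← offdiag s t s≢t 0 e
    cases (just (suc k)) e = map′ to from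
      (EndsInAlt-dec N (Descent-dec N) k t s x (ℕ.≤-pred (ℕ.≤-trans (ℕ.≤-reflexive (sym (length-snoc x s))) l)) (Reduced-++ˡ x red))
      where
      to : EndsInAlt x t s k → Descent (x ++ [ s ]) t
      to (z , q , e′) = EndsInAlt-Descent (EndsInAlt-braid e (z , (begin
        x ++ [ s ]                 ≈⟨ ++-congʳ [ s ] q ⟩
        (z ++ altR t s k) ++ [ s ] ≡⟨ snoc-assoc z (altR t s k) s ⟩
        z ++ altR t s k ++ [ s ]   ≡⟨ cong (z ++_) (altR-suc s t k) ⟨
        z ++ altR s t (suc k)      ∎) , trans (length-snoc x s) (trans (cong suc e′) (sym (ℕ.+-suc (length z) k)))))
        where open ≈-Reasoning
      from : Descent (x ++ [ s ]) t → EndsInAlt x t s k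
      from dt with two-descents red s≢t ds dt
      ... | k′ , e″ , z , q , e′ with just-injective (trans (sym e) e″)
      ... | refl = z , cancelʳ [ s ] (begin
        x ++ [ s ]                 ≈⟨ q ⟩
        z ++ altR s t (suc k)      ≡⟨ cong (z ++_) (altR-suc s t k) ⟩
        z ++ altR t s k ++ [ s ]   ≡⟨ snoc-assoc z (altR t s k) s ⟨
        (z ++ altR t s k) ++ [ s ] ∎) , ℕ.suc-injective (trans (sym (length-snoc x s)) (trans e′ (ℕ.+-suc (length z) k)))
        where open ≈-Reasoning

  -- Normal forms and decidable equality

  descent? : ∀ {w} → Reduced w → ∀ t → Dec (Descent w t)
  descent? {w} = Descent-dec (length w) w ℕ.≤-refl

  -- Letters are read from the front and multiplied on at the back, where each is appended or
  -- cancels a descent. This produces the inverse, and `nf` inverts beforehand to compensate.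
  normalise : ∀ w → ∃ λ r → r ≈ inv w × Reduced r
  normalise []      = [] , ≈.refl , λ _ _ → z≤n
  normalise (s ∷ w) with normalise w
  ... | r , p , red with descent? red s
  ...   | yes d@(x , q , e) = x , (begin
      x                ≈⟨ snoc-swap q ⟨
      r ++ [ s ]       ≈⟨ ++-congʳ [ s ] p ⟩
      inv w ++ [ s ]   ≡⟨ inv-∷ s w ⟨
      inv (s ∷ w)      ∎) , Reduced-++ˡ x (Descent-Reduced red d)
    where open ≈-Reasoning
  ...   | no ¬d = r ++ [ s ] , ≈.trans (++-congʳ [ s ] p) (≈.reflexive (sym (inv-∷ s w))) , ¬Descent⇒Reduced red ¬d

  abstract
    nf : Word → Word
    nf w = proj₁ (normalise (inv w))

    nf-≈ : ∀ w → nf w ≈ w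
    nf-≈ w = ≈.trans (proj₁ (proj₂ (normalise (inv w)))) (≈.reflexive (inv-inv w))

    nf-Reduced : ∀ w → Reduced (nf w)
    nf-Reduced w = proj₂ (proj₂ (normalise (inv w)))

  ℓ : Word → ℕ
  ℓ w = length (nf w)

  ℓ-min : ∀ {w w′} → w′ ≈ w → ℓ w ≤ length w′
  ℓ-min {w} p = nf-Reduced w _ (≈.trans p (≈.sym (nf-≈ w)))

  Reduced-ℓ : ∀ {r w} → Reduced r → r ≈ w → ℓ w ≡ length r
  Reduced-ℓ {r} {w} red p = Reduced-length (nf-Reduced w) red (≈.trans (nf-≈ w) (≈.sym p))

  ℓ-cong : ∀ {w w′} → w ≈ w′ → ℓ w ≡ ℓ w′
  ℓ-cong {w} {w′} p = sym (Reduced-ℓ (nf-Reduced w) (≈.trans (nf-≈ w) p))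

  ≈[]? : ∀ w → Dec (w ≈ [])
  ≈[]? w with nf w in e
  ... | []    = yes (≈.trans (≈.sym (nf-≈ w)) (≈.reflexive e))
  ... | _ ∷ _ = no λ p → contradiction (ℓ-min (≈.sym p)) (subst (λ r → ¬ (length r ≤ 0)) (sym e) λ ())

  abstract
    _≈?_ : Decidable _≈_
    x ≈? y = map′ to from (≈[]? (x ++ inv y))
      where
      to : (x ++ inv y) ≈ [] → x ≈ y
      to p = cancelʳ (inv y) (≈.trans p (≈.sym (inverseʳ y)))
      from : x ≈ y → (x ++ inv y) ≈ []
      from p = ≈.trans (++-congʳ (inv y) p) (inverseʳ y)

-- Bruhat order

module Bruhat {n : ℕ} (M : CoxeterMatrix n) where
  open import Data.Nat using (_+_)
  open CoxeterGroup M
  open WordProblem M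

  infix 4 _⊑_
  _⊑_ : Word → Word → Set
  _⊑_ = Sublist _≡_

  ⊑-refl : ∀ {x} → x ⊑ x
  ⊑-refl = Sub.refl refl

  ⊑-split : ∀ a {b x} → x ⊑ (a ++ b) → ∃ λ y → ∃ λ z → x ≡ y ++ z × y ⊑ a × z ⊑ b
  ⊑-split []      p        = [] , _ , refl , [] , p
  ⊑-split (_ ∷ a) (_ ∷ʳ p) with ⊑-split a p
  ... | y , z , e , q , r = y , z , e , _ ∷ʳ q , r
  ⊑-split (_ ∷ a) (e ∷ p) with ⊑-split a p
  ... | y , z , refl , q , r = _ ∷ y , z , refl , e ∷ q , r

  Subword : Word → Word → Set
  Subword u r = Σ Word λ x → x ⊑ r × x ≈ u

  Subword-cong : ∀ {u u′ r} → u ≈ u′ → Subword u r → Subword u′ r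
  Subword-cong p (x , q , e) = x , q , ≈.trans e p

  Subword-inv : ∀ {u r} → Subword u r → Subword (inv u) (inv r)
  Subword-inv (x , q , e) = inv x , Sub.reverse⁺ q , inv-cong e

  Subword-++ : ∀ {u v a b} → Subword u a → Subword v b → Subword (u ++ v) (a ++ b)
  Subword-++ (x , p , e) (y , q , f) = x ++ y , Sub.++⁺ p q , ++-cong e f

  Subword-split : ∀ a {b u} → Subword u (a ++ b) → ∃ λ v → ∃ λ w → (v ++ w) ≈ u × Subword v a × Subword w b
  Subword-split a (x , p , e) with ⊑-split a p
  ... | y , z , refl , q , r = y , z , e , (y , q , ≈.refl) , (z , r , ≈.refl)

  alt-⊑ : ∀ s t {j k} → j ≤ k → alt s t j ⊑ alt s t k
  alt-⊑ s t z≤n     = minimum _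
  alt-⊑ s t (s≤s l) = refl ∷ alt-⊑ t s l

  -- Omitting an inner letter brings two equal letters together, and these cancel; only shorter
  -- alternating words survive.
  ⊑-alt : ∀ s t k {x} → x ⊑ alt s t k →
          x ≡ alt s t k ⊎ ∃ λ j → j < k × (x ≈ alt s t j ⊎ x ≈ alt t s j)
  ⊑-alt s t zero    []       = inj₁ refl
  ⊑-alt s t (suc k) (_ ∷ʳ p) with ⊑-alt t s k p
  ... | inj₁ refl        = inj₂ (k , ℕ.≤-refl , inj₂ ≈.refl)
  ... | inj₂ (j , l , e) = inj₂ (j , ℕ.m≤n⇒m≤1+n l , Sum.swap e)
  ⊑-alt s t (suc k) (refl ∷ p) with ⊑-alt t s k p
  ... | inj₁ refl               = inj₁ refl
  ... | inj₂ (j , l , inj₁ e)   = inj₂ (suc j , s≤s l , inj₁ (∷-cong s e))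
  ... | inj₂ (zero , l , inj₂ e) = inj₂ (1 , s≤s l , inj₁ (∷-cong s e))
  ... | inj₂ (suc j , l , inj₂ e) =
    inj₂ (j , ℕ.≤-trans (ℕ.n≤1+n _) (ℕ.m≤n⇒m≤1+n l) , inj₂ (≈.trans (∷-cong s e) (ss≈ s _)))

  -- A proper subword equals an alternating word of length below `k`, and with either first letter
  -- such a word occurs in `alt t s k`. The full word is handled by the braid relation.
  Subword-alt-braid : ∀ {s t k u} → m s t ≡ just k → Subword u (alt s t k) → Subword u (alt t s k)
  Subword-alt-braid {s} {t} {k} e (x , p , q) with ⊑-alt s t k p
  ... | inj₁ refl = alt t s k , ⊑-refl , ≈.trans (≈.sym (alt-braid e)) q
  ... | inj₂ (j , l , inj₂ r) = alt t s j , alt-⊑ t s (ℕ.<⇒≤ l) , ≈.trans (≈.sym r) q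
  Subword-alt-braid {s} {t} {suc k} e (x , p , q) | inj₂ (j , s≤s l , inj₁ r) =
    alt s t j , t ∷ʳ alt-⊑ s t l , ≈.trans (≈.sym r) q

  Subword-altR-braid : ∀ {s t k u} → m s t ≡ just k → Subword u (altR s t k) → Subword u (altR t s k)
  Subword-altR-braid {s} {t} {k} {u} e p = subst (λ - → Subword - (altR t s k)) (inv-inv u)
    (Subword-inv (Subword-alt-braid e (subst (Subword (inv u)) (inv-inv (alt s t k)) (Subword-inv p))))

  -- Independence of the reduced expression

  Invariant : ℕ → Set
  Invariant N = ∀ r r′ → length r ≤ N → Reduced r → r ≈ r′ → length r ≡ length r′ →
                ∀ {u} → Subword u r → Subword u r′

  same-last : ∀ {N} → Invariant N → ∀ x y s → length x ≤ N → Reduced (x ++ [ s ]) → (x ++ [ s ]) ≈ (y ++ [ s ]) →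
              length x ≡ length y → ∀ {u} → Subword u (x ++ [ s ]) → Subword u (y ++ [ s ])
  same-last inv x y s l red e len p with Subword-split x p
  ... | v , w , q , pv , pw = Subword-cong q (Subword-++ (inv x y l (Reduced-++ˡ x red) (cancelʳ [ s ] e) len pv) pw)

  -- Reduced words with last letters `s` and `t` are joined through `z` followed by the two braid
  -- words: equal last letters are settled by induction, the braid in between by
  -- `Subword-altR-braid`. As in Matsumoto's theorem, this makes one reduced expression enough to
  -- establish `_≤B_`.
  Subword-invariant : ∀ N → Invariant N
  Subword-invariant N r r′ l red e len p with initLast r | initLast r′
  ... | [] | [] = p
  ... | [] | y ∷ʳ′ t with () ← trans len (length-snoc y t)
  ... | x ∷ʳ′ s | [] with () ← trans (sym len) (length-snoc x s)
  Subword-invariant zero _ _ l red e len p | x ∷ʳ′ s | y ∷ʳ′ t with () ← ℕ.≤-trans (ℕ.≤-reflexive (sym (length-snoc x s))) l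
  Subword-invariant (suc N) _ _ l red e len p | x ∷ʳ′ s | y ∷ʳ′ t with s Fin.≟ t
  ... | yes refl = same-last (Subword-invariant N) x y s
    (ℕ.≤-pred (ℕ.≤-trans (ℕ.≤-reflexive (sym (length-snoc x s))) l)) red e
    (ℕ.suc-injective (trans (sym (length-snoc x s)) (trans len (length-snoc y s)))) p
  ... | no s≢t with two-descents red s≢t (x , ≈.refl , length-snoc x s) (y , e , trans len (length-snoc y t))
  ... | zero , e₀ , _ with () ← offdiag s t s≢t 0 e₀
  ... | suc k , eₖ , z , q , zl =
    same-last (Subword-invariant N) (z ++ altR s t k) y t
      (ℕ.≤-trans (ℕ.≤-reflexive (trans |zt| (sym |x|))) x≤N)
      (Reduced-resp red (≈.sym r≈t) (trans (length-snoc (z ++ altR s t k) t) (trans (cong suc |zt|) (sym r-len))))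
      (≈.trans (≈.sym r≈t) e)
      (trans |zt| (ℕ.suc-injective (trans (sym r-len) (trans len (length-snoc y t)))))
      (subst (Subword _) (z-altR t s) (braid-middle
        (subst (Subword _) (sym (z-altR s t))
          (same-last (Subword-invariant N) x (z ++ altR t s k) s x≤N red r≈s
            (trans |x| (sym |zs|)) p))))
    where
    z-altR : ∀ s t → z ++ altR s t (suc k) ≡ (z ++ altR t s k) ++ [ s ]
    z-altR s t = trans (cong (z ++_) (altR-suc s t k)) (sym (snoc-assoc z (altR t s k) s))
    x≤N : length x ≤ N
    x≤N = ℕ.≤-pred (ℕ.≤-trans (ℕ.≤-reflexive (sym (length-snoc x s))) l)
    r-len : length (x ++ [ s ]) ≡ suc (length z + k)
    r-len = trans zl (ℕ.+-suc (length z) k)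
    |x| : length x ≡ length z + k
    |x| = ℕ.suc-injective (trans (sym (length-snoc x s)) r-len)
    |zs| : length (z ++ altR t s k) ≡ length z + k
    |zs| = trans (List.length-++ z) (cong (length z +_) (length-altR t s k))
    |zt| : length (z ++ altR s t k) ≡ length z + k
    |zt| = trans (List.length-++ z) (cong (length z +_) (length-altR s t k))
    r≈s : (x ++ [ s ]) ≈ ((z ++ altR t s k) ++ [ s ])
    r≈s = ≈.trans q (≈.reflexive (z-altR s t))
    r≈t : (x ++ [ s ]) ≈ ((z ++ altR s t k) ++ [ t ])
    r≈t = ≈.trans q (≈.trans (++-congˡ z (altR-braid eₖ)) (≈.reflexive (z-altR t s)))
    braid-middle : ∀ {u} → Subword u (z ++ altR s t (suc k)) → Subword u (z ++ altR t s (suc k))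
    braid-middle p with Subword-split z p
    ... | v , w , q , pv , pw = Subword-cong q (Subword-++ pv (Subword-altR-braid eₖ pw))

  ≤B-intro : ∀ {u v} r → Reduced r → r ≈ v → Subword u r → u ≤B v
  ≤B-intro r red e p r′ e′ red′ =
    Subword-invariant (length r) r r′ ℕ.≤-refl red e″ (Reduced-length red red′ e″) p
    where e″ = ≈.trans e (≈.sym e′)

  ≤B⇒Subword : ∀ {u v} → u ≤B v → Subword u (nf v)
  ≤B⇒Subword {v = v} p = p (nf v) (nf-≈ v) (nf-Reduced v)

  Subword⇒≤B : ∀ {u v} → Subword u (nf v) → u ≤B v
  Subword⇒≤B {v = v} = ≤B-intro (nf v) (nf-Reduced v) (nf-≈ v)

  -- Deletion only strikes out letters, so shortening never leaves `r`. Transitivity depends on it,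
  -- because `_≤B_` can be applied to reduced words only.
  reduce : ∀ {u r} → Subword u r → ∃ λ x → x ⊑ r × x ≈ u × Reduced x
  reduce {u} {r} (x , p , e) = go (length x) x ℕ.≤-refl p e
    where
    go : ∀ N x → length x ≤ N → x ⊑ r → x ≈ u → ∃ λ x → x ⊑ r × x ≈ u × Reduced x
    go N x l p e with length x ℕ.≤? ℓ x
    ... | yes x≤ℓ = x , p , e , Reduced-resp (nf-Reduced x) (≈.sym (nf-≈ x)) (ℕ.≤-antisym x≤ℓ (ℓ-min ≈.refl))
    ... | no  x≰ℓ with shorten (deletion-of-≈ (≈.sym (nf-≈ x)) (ℕ.≰⇒> x≰ℓ))
    go zero    x l p e | no _ | y , f , q , y⊑x with () ← ℕ.≤-trans q l
    go (suc N) x l p e | no _ | y , f , q , y⊑x =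
      go N y (ℕ.≤-pred (ℕ.≤-trans q l)) (Sub.trans trans y⊑x p) (≈.trans f e)

  ≤B-trans : ∀ {u v w} → u ≤B v → v ≤B w → u ≤B w
  ≤B-trans p q r e red with reduce (q r e red)
  ... | x , x⊑r , x≈v , x-red with p x x≈v x-red
  ... | y , y⊑x , y≈u = y , Sub.trans trans y⊑x x⊑r , y≈u

  ≤B-respˡ : ∀ {u u′ v} → u ≈ u′ → u ≤B v → u′ ≤B v
  ≤B-respˡ e p r f red = Subword-cong e (p r f red)

  ≤B-respʳ : ∀ {u v v′} → v ≈ v′ → u ≤B v → u ≤B v′
  ≤B-respʳ e p r f red = p r (≈.trans f (≈.sym e)) red

  ≤B-inv : ∀ {u v} → u ≤B v → inv u ≤B inv v
  ≤B-inv {v = v} p = ≤B-intro (inv (nf v)) (Reduced-inv (nf-Reduced v)) (inv-cong (nf-≈ v)) (Subword-inv (≤B⇒Subword p))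

  ≤B⇒ℓ≤ : ∀ {u v} → u ≤B v → ℓ u ≤ ℓ v
  ≤B⇒ℓ≤ p with ≤B⇒Subword p
  ... | x , x⊑ , e = ℕ.≤-trans (ℓ-min e) (Sub.length-mono-≤ x⊑)

  ≤B⇒≈ : ∀ {u v} → u ≤B v → ℓ v ≤ ℓ u → u ≈ v
  ≤B⇒≈ {u} {v} p l with ≤B⇒Subword p
  ... | x , x⊑ , e = ≈.trans (≈.sym e) (≈.trans (≈.reflexive x≡nf) (nf-≈ v))
    where
    x≡nf : x ≡ nf v
    x≡nf = PW.Pointwise-≡⇒≡ (Sub.toPointwise (ℕ.≤-antisym (Sub.length-mono-≤ x⊑) (ℕ.≤-trans l (ℓ-min e))) x⊑)

  <B⇒ℓ< : ∀ {u v} → u <B v → ℓ u < ℓ v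
  <B⇒ℓ< (p , u≉v) = ℕ.≰⇒> (u≉v ∘ ≤B⇒≈ p)

  ≤B∧ℓ<⇒<B : ∀ {u v} → u ≤B v → ℓ u < ℓ v → u <B v
  ≤B∧ℓ<⇒<B p l = p , λ e → ℕ.<⇒≢ l (ℓ-cong e)

  <B-≤B-trans : ∀ {u v w} → u <B v → v ≤B w → u <B w
  <B-≤B-trans p q = ≤B∧ℓ<⇒<B (≤B-trans (proj₁ p) q) (ℕ.≤-trans (<B⇒ℓ< p) (≤B⇒ℓ≤ q))

  <B-isStrictPartialOrder : IsStrictPartialOrder _≈_ _<B_
  <B-isStrictPartialOrder = record
    { isEquivalence = ≈.isEquivalence
    ; irrefl        = λ e (_ , n) → n e
    ; trans         = λ p q → <B-≤B-trans p (proj₁ q)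
    ; <-resp-≈      = (λ e (p , n) → ≤B-respʳ e p , λ f → n (≈.trans f (≈.sym e)))
                    , (λ e (p , n) → ≤B-respˡ e p , λ f → n (≈.trans e f))
    }

  subwords : Word → List Word
  subwords []      = [ [] ]
  subwords (s ∷ w) = map (s ∷_) (subwords w) ++ subwords w

  subwords-complete : ∀ {x w} → x ⊑ w → Any (x ≡_) (subwords w)
  subwords-complete []                  = here refl
  subwords-complete {w = s ∷ w} (_ ∷ʳ p)   = Any.++⁺ʳ (map (s ∷_) (subwords w)) (subwords-complete p)
  subwords-complete {w = s ∷ w} (refl ∷ p) = Any.++⁺ˡ (Any.map⁺ (Any.map (cong (s ∷_)) (subwords-complete p)))

  subwords-sound : ∀ {x} w → Any (x ≡_) (subwords w) → x ⊑ w
  subwords-sound [] (here refl) = []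
  subwords-sound (s ∷ w) p with Any.++⁻ (map (s ∷_) (subwords w)) p
  ... | inj₂ q = s ∷ʳ subwords-sound w q
  ... | inj₁ q with Any.satisfied (Any.map⁻ q) | Any.map⁻ q
  ... | _ | r = tail r
    where
    tail : ∀ {x} → Any (λ y → x ≡ s ∷ y) (subwords w) → x ⊑ (s ∷ w)
    tail {[]}    r with () ← proj₂ (Any.satisfied r)
    tail {_ ∷ x} r with List.∷-injectiveˡ (proj₂ (Any.satisfied r))
    ... | refl = refl ∷ subwords-sound w (Any.map List.∷-injectiveʳ r)

  ≤B⇒∈ : ∀ {u v} → u ≤B v → Any (u ≈_) (subwords (nf v))
  ≤B⇒∈ p with ≤B⇒Subword p
  ... | x , x⊑ , e = Any.map (λ { refl → ≈.sym e }) (subwords-complete x⊑)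

  _≤B?_ : Decidable _≤B_
  u ≤B? v = map′ to ≤B⇒∈ (Any.any? (u ≈?_) (subwords (nf v)))
    where
    to : Any (u ≈_) (subwords (nf v)) → u ≤B v
    to p = Subword⇒≤B (find (subwords (nf v)) (λ q → subwords-sound (nf v) q) p)
      where
      find : ∀ ws → (∀ {x} → Any (x ≡_) ws → x ⊑ nf v) → Any (u ≈_) ws → Subword u (nf v)
      find (x ∷ _)  f (here e)  = x , f (here refl) , ≈.sym e
      find (_ ∷ ws) f (there p) = find ws (f ∘ there) p

  _<B?_ : Decidable _<B_
  u <B? v = (u ≤B? v) ×-dec ¬? (u ≈? v)

  -- Descents and the lifting property

  Descends : Word → Fin n → Set
  Descends w s = ℓ (w ++ [ s ]) < ℓ w

  Descends? : ∀ w s → Dec (Descends w s)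
  Descends? w s = ℓ (w ++ [ s ]) ℕ.<? ℓ w

  Descends-resp : ∀ {w w′ s} → w ≈ w′ → Descends w s → Descends w′ s
  Descends-resp {s = s} e = subst₂ _<_ (ℓ-cong (++-congʳ [ s ] e)) (ℓ-cong e)

  Descent⇒Descends : ∀ {w s} → Descent (nf w) s → Descends w s
  Descent⇒Descends {w} {s} (x , p , e) = ℕ.≤-trans (s≤s (ℓ-min (≈.sym (snoc-swap (≈.trans (≈.sym (nf-≈ w)) p)))))
    (ℕ.≤-reflexive (sym e))

  ℓ-snoc : ∀ {w s} → ¬ Descent (nf w) s → ℓ (w ++ [ s ]) ≡ suc (ℓ w)
  ℓ-snoc {w} {s} ¬d = trans
    (Reduced-ℓ (¬Descent⇒Reduced (nf-Reduced w) ¬d) (++-congʳ [ s ] (nf-≈ w))) (length-snoc (nf w) s)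

  ascent : ∀ {w s} → ¬ Descends w s → Reduced (nf w ++ [ s ])
  ascent {w} ¬d = ¬Descent⇒Reduced (nf-Reduced w) (¬d ∘ Descent⇒Descends)

  Descends⇒Descent : ∀ {w s} → Descends w s → Descent (nf w) s
  Descends⇒Descent {w} {s} d with descent? (nf-Reduced w) s
  ... | yes p = p
  ... | no ¬p = contradiction (ℕ.≤-trans (ℕ.n≤1+n (ℓ w)) (ℕ.≤-reflexive (sym (ℓ-snoc ¬p)))) (ℕ.<⇒≱ d)

  ascent-≤B : ∀ {w s} → ¬ Descends w s → w ≤B (w ++ [ s ])
  ascent-≤B {w} {s} ¬d = ≤B-intro (nf w ++ [ s ]) (ascent ¬d) (++-congʳ [ s ] (nf-≈ w))
    (nf w , Sub.++ʳ [ s ] ⊑-refl , nf-≈ w)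

  ¬Descends-snoc : ∀ {w s} → Descends w s → ¬ Descends (w ++ [ s ]) s
  ¬Descends-snoc {w} {s} d d′ = ℕ.<-asym d (subst (_< ℓ (w ++ [ s ])) (ℓ-cong (snoc-swap {w ++ [ s ]} {w} ≈.refl)) d′)

  descent-≤B : ∀ {w s} → Descends w s → (w ++ [ s ]) ≤B w
  descent-≤B {w} {s} d = ≤B-respʳ (snoc-swap ≈.refl) (ascent-≤B (¬Descends-snoc d))

  -- A subword of the reduced word `x s` for `u` avoids the final `s` and lies in `x`, or it uses
  -- it. In the second case u s lies below `x`, and `u` lies below u s.
  lifting : ∀ {u v s} → u ≤B v → ¬ Descends u s → Descends v s → u ≤B (v ++ [ s ])
  lifting {u} {v} {s} p ¬d d = below-x (p (x ++ [ s ]) (≈.trans (≈.sym q) (nf-≈ v)) xs-red)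
    where
    dv = Descends⇒Descent d
    x  = proj₁ dv
    q  = proj₁ (proj₂ dv)
    xs-red : Reduced (x ++ [ s ])
    xs-red = Descent-Reduced (nf-Reduced v) dv
    via-x : ∀ {w} → Subword w x → w ≤B (v ++ [ s ])
    via-x = ≤B-intro x (Reduced-++ˡ x xs-red) (≈.sym (snoc-swap (≈.trans (≈.sym (nf-≈ v)) q)))
    below-x : Subword u (x ++ [ s ]) → u ≤B (v ++ [ s ])
    below-x (y , y⊑ , y≈u) with ⊑-split x y⊑
    ... | y₁ , .[]      , refl , y₁⊑x , (_ ∷ʳ [])   = via-x (y₁ , y₁⊑x , ≈.trans (≈.sym (++-[] y₁)) y≈u)
    ... | y₁ , .([ s ]) , refl , y₁⊑x , (refl ∷ []) = ≤B-trans (ascent-≤B ¬d)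
      (via-x (y₁ , y₁⊑x , ≈.sym (snoc-swap (≈.sym y≈u))))

  ℓ-inv : ∀ w → ℓ (inv w) ≡ ℓ w
  ℓ-inv w = trans (Reduced-ℓ (Reduced-inv (nf-Reduced w)) (inv-cong (nf-≈ w))) (List.length-reverse (nf w))

-- Twisted identities

module Inversions {n : ℕ} (M : CoxeterMatrix n) where
  open CoxeterGroup M
  open WordProblem M
  open Permutation ≈-setoid using (_↭_; ↭-reflexive-≋)

  -- With equality decided, the parity of a multiplicity can be computed; it is constant on the
  -- classes of `_∼_`.
  odd : Word → List Word → Bool
  odd t []       = false
  odd t (x ∷ xs) = does (t ≈? x) xor odd t xs

  does-congʳ : ∀ t {x y} → x ≈ y → does (t ≈? x) ≡ does (t ≈? y)
  does-congʳ t {x} {y} e = does-⇔ (mk⇔ (λ p → ≈.trans p e) (λ p → ≈.trans p (≈.sym e))) (t ≈? x) (t ≈? y)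

  odd-congˡ : ∀ {t t′} → t ≈ t′ → ∀ xs → odd t xs ≡ odd t′ xs
  odd-congˡ e []       = refl
  odd-congˡ {t} {t′} e (x ∷ xs) = cong₂ _xor_
    (does-⇔ (mk⇔ (≈.trans (≈.sym e)) (≈.trans e)) (t ≈? x) (t′ ≈? x)) (odd-congˡ e xs)

  odd-↭ : ∀ t {xs ys} → xs ↭ ys → odd t xs ≡ odd t ys
  odd-↭ t (Permutation.refl [])       = refl
  odd-↭ t (Permutation.refl (e ∷ es)) = cong₂ _xor_ (does-congʳ t e) (odd-↭ t (Permutation.refl es))
  odd-↭ t (Permutation.prep e p)      = cong₂ _xor_ (does-congʳ t e) (odd-↭ t p)
  odd-↭ t (Permutation.swap {xs} {ys} {x} {y} {x′} {y′} e f p) = begin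
    does (t ≈? x) xor (does (t ≈? y) xor odd t xs)
      ≡⟨ Bool.xor-assoc (does (t ≈? x)) _ _ ⟨
    (does (t ≈? x) xor does (t ≈? y)) xor odd t xs
      ≡⟨ cong₂ _xor_ (trans (cong₂ _xor_ (does-congʳ t e) (does-congʳ t f)) (Bool.xor-comm (does (t ≈? x′)) _)) (odd-↭ t p) ⟩
    (does (t ≈? y′) xor does (t ≈? x′)) xor odd t ys
      ≡⟨ Bool.xor-assoc (does (t ≈? y′)) _ _ ⟩
    does (t ≈? y′) xor (does (t ≈? x′) xor odd t ys) ∎
    where open ≡-Reasoning
  odd-↭ t (Permutation.trans p q)     = trans (odd-↭ t p) (odd-↭ t q)

  odd-++ : ∀ t xs ys → odd t (xs ++ ys) ≡ odd t xs xor odd t ys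
  odd-++ t []       ys = refl
  odd-++ t (x ∷ xs) ys = trans (cong (does (t ≈? x) xor_) (odd-++ t xs ys))
    (sym (Bool.xor-assoc (does (t ≈? x)) _ _))

  xor-injective : ∀ b c → b xor c ≡ false → b ≡ c
  xor-injective true  true  _ = refl
  xor-injective false c     e = sym e

  odd-∼ : ∀ t {xs ys} → xs ∼ ys → odd t xs ≡ odd t ys
  odd-∼ t {xs} {ys} (zs , p) = xor-injective _ _ (begin
    odd t xs xor odd t ys ≡⟨ odd-++ t xs ys ⟨
    odd t (xs ++ ys)      ≡⟨ odd-↭ t p ⟩
    odd t (zs ++ zs)      ≡⟨ odd-++ t zs zs ⟩
    odd t zs xor odd t zs ≡⟨ Bool.xor-same (odd t zs) ⟩
    false                 ∎)
    where open ≡-Reasoning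

  odd⇒Any : ∀ t xs → odd t xs ≡ true → Any (t ≈_) xs
  odd⇒Any t (x ∷ xs) e with t ≈? x
  ... | yes p = here p
  ... | no _  = there (odd⇒Any t xs e)

  odd-map : ∀ {t t′} (f : Word → Word) → (∀ x → t ≈ f x → t′ ≈ x) → (∀ x → t′ ≈ x → t ≈ f x) →
            ∀ xs → odd t (map f xs) ≡ odd t′ xs
  odd-map f to from []       = refl
  odd-map {t} {t′} f to from (x ∷ xs) =
    cong₂ _xor_ (does-⇔ (mk⇔ (to x) (from x)) (t ≈? f x) (t′ ≈? x)) (odd-map f to from xs)

  -- For a reflection t this decides whether t is a left inversion of w.
  η : Word → Word → Bool
  η w t = odd t (reflections w)

  η-cong : ∀ {w w′} t → w ≈ w′ → η w t ≡ η w′ t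
  η-cong {w} {w′} t e = odd-∼ t {reflections w} {reflections w′} (reflections-cong e)

  η-congʳ : ∀ w {t t′} → t ≈ t′ → η w t ≡ η w t′
  η-congʳ w e = odd-congˡ e (reflections w)

  conj-cancel : ∀ a {t x} → conj a t ≈ x → t ≈ conj a x
  conj-cancel a {t} p = ≈.trans (≈.sym (conj-conj a t)) (conj-cong a p)

  η-∷ : ∀ a w t → η (a ∷ w) t ≡ does (t ≈? [ a ]) xor η w (conj a t)
  η-∷ a w t = cong (does (t ≈? [ a ]) xor_)
    (odd-map (conj a) (λ _ → conj-swap a) (λ _ → conj-cancel a) (reflections w))

  conjBy-swap : ∀ x {t u} → t ≈ conjBy x u → conjBy (inv x) t ≈ u
  conjBy-swap x {t} {u} p = begin
    inv x ++ t ++ inv (inv x)          ≡⟨ cong (λ - → inv x ++ t ++ -) (inv-inv x) ⟩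
    inv x ++ t ++ x                    ≈⟨ ++-congˡ (inv x) (++-congʳ x p) ⟩
    inv x ++ (x ++ u ++ inv x) ++ x    ≡⟨ cong (inv x ++_) (trans (List.++-assoc x (u ++ inv x) x) (cong (x ++_) (List.++-assoc u (inv x) x))) ⟩
    inv x ++ x ++ u ++ inv x ++ x      ≈⟨ assoc (inv x) x _ ⟨
    (inv x ++ x) ++ u ++ inv x ++ x    ≈⟨ ++-cong (inverseˡ x) (++-congˡ u (inverseˡ x)) ⟩
    u ++ []                            ≈⟨ ++-[] u ⟩
    u                                  ∎
    where open ≈-Reasoning

  -- The reflections of the second factor enter conjugated by the first: the cocycle rule for
  -- inversion sets.
  η-++ : ∀ x y t → η (x ++ y) t ≡ η x t xor η y (conjBy (inv x) t)
  η-++ x y t = begin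
    odd t (reflections (x ++ y))
      ≡⟨ odd-↭ t (↭-reflexive-≋ (reflections-++ x y)) ⟩
    odd t (reflections x ++ map (conjBy x) (reflections y))
      ≡⟨ odd-++ t (reflections x) _ ⟩
    η x t xor odd t (map (conjBy x) (reflections y))
      ≡⟨ cong (η x t xor_) (odd-map (conjBy x) (λ _ → conjBy-swap x) from (reflections y)) ⟩
    η x t xor η y (conjBy (inv x) t) ∎
    where
    open ≡-Reasoning
    from : ∀ u → conjBy (inv x) t ≈ u → t ≈ conjBy x u
    from u p = ≈.sym (subst (λ - → conjBy - u ≈ t) (inv-inv x) (conjBy-swap (inv x) (≈.sym p)))

  -- If `w` contributed `[ s ]` an odd number of times, it would occur there, and the leading `s`
  -- together with that letter would be a deletion.
  η-head : ∀ {s w} → Reduced (s ∷ w) → η (s ∷ w) [ s ] ≡ true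
  η-head {s} {w} red = begin
    η (s ∷ w) [ s ]                                 ≡⟨ η-∷ s w [ s ] ⟩
    does ([ s ] ≈? [ s ]) xor η w (conj s [ s ])    ≡⟨ cong₂ _xor_ (dec-true ([ s ] ≈? [ s ]) ≈.refl) (η-congʳ w (ss≈ s [ s ])) ⟩
    true xor η w [ s ]                              ≡⟨ cong (true xor_) (not-inversion (η w [ s ]) refl) ⟩
    true                                            ∎
    where
    open ≡-Reasoning
    not-inversion : ∀ b → η w [ s ] ≡ b → b ≡ false
    not-inversion false _ = refl
    not-inversion true  e with reflection-split w (odd⇒Any [ s ] (reflections w) e)
    ... | b , y , c , refl , p = contradiction (deletion {a = []} {b} refl p) (Reduced⇒¬Deletion red)

-- Conjugating twisted identities by a generator

module TwistedIdentities {n : ℕ} (M : CoxeterMatrix n) (A : Coxeter.Automorphism M)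
                         (involutive : Coxeter.Involutive M A) where
  open CoxeterGroup M
  open WordProblem M
  open Bruhat M
  open Inversions M
  open Automorphism A
  open Twisted A

  τ : Fin n → Fin n
  τ s = proj₁ (θ-S s)

  -- A letterwise model of `θ`. It commutes with concatenation and reversal on the nose and
  -- preserves the length of words, which the axioms do not give for `θ` itself.
  Θ : Word → Word
  Θ = map τ

  θ≈Θ : ∀ w → θ w ≈ Θ w
  θ≈Θ []      = ≈.sym (cancelˡ (θ []) (≈.trans (++-[] (θ [])) (θ-hom [] [])))
  θ≈Θ (s ∷ w) = ≈.trans (θ-hom [ s ] w) (++-cong (proj₂ (θ-S s)) (θ≈Θ w))

  Θ-cong : ∀ {x y} → x ≈ y → Θ x ≈ Θ y
  Θ-cong {x} {y} e = ≈.trans (≈.sym (θ≈Θ x)) (≈.trans (θ-cong e) (θ≈Θ y))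

  Θ-involutive : ∀ w → Θ (Θ w) ≈ w
  Θ-involutive w = ≈.trans (≈.sym (≈.trans (θ-cong (θ≈Θ w)) (θ≈Θ (Θ w)))) (involutive w)

  Θ-injective : ∀ {x y} → Θ x ≈ Θ y → x ≈ y
  Θ-injective {x} {y} e = ≈.trans (≈.sym (Θ-involutive x)) (≈.trans (Θ-cong e) (Θ-involutive y))

  Θ-++ : ∀ x y → Θ (x ++ y) ≡ Θ x ++ Θ y
  Θ-++ = List.map-++ τ

  Θ-inv : ∀ x → Θ (inv x) ≡ inv (Θ x)
  Θ-inv = List.reverse-map τ

  ℓ-Θ : ∀ w → ℓ (Θ w) ≡ ℓ w
  ℓ-Θ w = ℕ.≤-antisym (bound w) (ℕ.≤-trans (ℕ.≤-reflexive (ℓ-cong (≈.sym (Θ-involutive w)))) (bound (Θ w)))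
    where
    bound : ∀ w → ℓ (Θ w) ≤ ℓ w
    bound w = ℕ.≤-trans (ℓ-min (Θ-cong (nf-≈ w))) (ℕ.≤-reflexive (List.length-map τ (nf w)))

  η-Θ : ∀ w t → η (Θ w) (Θ t) ≡ η w t
  η-Θ []      t = refl
  η-Θ (a ∷ w) t = begin
    η (τ a ∷ Θ w) (Θ t)
      ≡⟨ η-∷ (τ a) (Θ w) (Θ t) ⟩
    does (Θ t ≈? [ τ a ]) xor η (Θ w) (conj (τ a) (Θ t))
      ≡⟨ cong₂ _xor_ (does-⇔ (mk⇔ Θ-injective Θ-cong) (Θ t ≈? [ τ a ]) (t ≈? [ a ]))
           (trans (cong (λ u → η (Θ w) (τ a ∷ u)) (sym (Θ-++ t [ a ]))) (η-Θ w (conj a t))) ⟩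
    does (t ≈? [ a ]) xor η w (conj a t)
      ≡⟨ η-∷ a w t ⟨
    η (a ∷ w) t ∎
    where open ≡-Reasoning

  twist : Fin n → Word → Word
  twist s x = τ s ∷ x ++ [ s ]

  twist-cong : ∀ s {x y} → x ≈ y → twist s x ≈ twist s y
  twist-cong s e = ∷-cong (τ s) (++-congʳ [ s ] e)

  twist-snoc : ∀ s x → (twist s x ++ [ s ]) ≈ (τ s ∷ x)
  twist-snoc s x = ∷-cong (τ s) (snoc-swap ≈.refl)

  twist-involutive : ∀ s x → twist s (twist s x) ≈ x
  twist-involutive s x = ≈.trans (∷-cong (τ s) (twist-snoc s x)) (ss≈ (τ s) x)

  twist-swap : ∀ s {x y} → x ≈ twist s y → twist s x ≈ y
  twist-swap s e = ≈.trans (twist-cong s e) (twist-involutive s _)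

  TI-cong : IsTwistedIdentity Respects _≈_
  TI-cong e (w , p) = w , ≈.trans (≈.sym e) p

  TI-intro : ∀ {x} w → x ≈ (inv (Θ w) ++ w) → IsTwistedIdentity x
  TI-intro {x} w p = w , ≈.trans p (++-congʳ w (≈.sym (≈.trans (θ≈Θ (inv w)) (≈.reflexive (Θ-inv w)))))

  TI-elim : ∀ {x} → IsTwistedIdentity x → ∃ λ w → x ≈ (inv (Θ w) ++ w)
  TI-elim (w , p) = w , ≈.trans p (++-congʳ w (≈.trans (θ≈Θ (inv w)) (≈.reflexive (Θ-inv w))))

  TI-twist : ∀ {x} s → IsTwistedIdentity x → IsTwistedIdentity (twist s x)
  TI-twist {x} s ti with TI-elim ti
  ... | w , p = TI-intro (w ++ [ s ]) (begin
    twist s x                                ≈⟨ twist-cong s p ⟩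
    τ s ∷ (inv (Θ w) ++ w) ++ [ s ]          ≡⟨ cong (τ s ∷_) (List.++-assoc (inv (Θ w)) w [ s ]) ⟩
    (τ s ∷ inv (Θ w)) ++ w ++ [ s ]          ≡⟨ cong (_++ w ++ [ s ]) (trans (cong inv (Θ-++ w [ s ])) (inv-++ (Θ w) [ τ s ])) ⟨
    inv (Θ (w ++ [ s ])) ++ w ++ [ s ]       ∎)
    where open ≈-Reasoning

  TI-inv : ∀ {x} → IsTwistedIdentity x → ∃ λ w → inv x ≈ (inv w ++ Θ w) × x ≈ (inv (Θ w) ++ w)
  TI-inv {x} ti with TI-elim ti
  ... | w , p = w , ≈.trans (inv-cong p) (≈.reflexive (trans (inv-++ (inv (Θ w)) w) (cong (inv w ++_) (inv-inv (Θ w))))) , p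

  -- Inverting θ(w⁻¹) w and applying the involution to it both give w⁻¹ θ(w). Left descents of `x`
  -- are thereby the images under `τ` of its right descents.
  inv≈Θ : ∀ {x} → IsTwistedIdentity x → inv x ≈ Θ x
  inv≈Θ {x} ti with TI-inv ti
  ... | w , p , q = begin
    inv x                   ≈⟨ p ⟩
    inv w ++ Θ w            ≈⟨ ++-congʳ (Θ w) (Θ-involutive (inv w)) ⟨
    Θ (Θ (inv w)) ++ Θ w    ≡⟨ cong (λ - → Θ - ++ Θ w) (Θ-inv w) ⟩
    Θ (inv (Θ w)) ++ Θ w    ≡⟨ Θ-++ (inv (Θ w)) w ⟨
    Θ (inv (Θ w) ++ w)      ≈⟨ Θ-cong q ⟨
    Θ x                     ∎
    where open ≈-Reasoning

  -- For x = θ(w⁻¹) w with θ(s) x s = x, the reflection t = w s w⁻¹ is fixed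
  -- by θ, so w and θ(w) contribute equally to the multiplicity of s among
  -- the inversions of x⁻¹ = w⁻¹ θ(w), which is therefore even.
  fixed⇒¬Descends : ∀ {x s} → IsTwistedIdentity x → twist s x ≈ x → ¬ Descends x s
  fixed⇒¬Descends {x} {s} ti fix d with TI-inv ti
  ... | w , p , q = contradiction (trans (sym odd-mult) even-mult) λ ()
    where
    t = conjBy (inv (inv w)) [ s ]
    Θt≈t : Θ t ≈ t
    Θt≈t = begin
      Θ t                              ≡⟨ cong (λ - → Θ (- ++ [ s ] ++ inv -)) (inv-inv w) ⟩
      Θ (w ++ [ s ] ++ inv w)          ≡⟨ trans (Θ-++ w _) (cong (λ - → Θ w ++ τ s ∷ -) (Θ-inv w)) ⟩
      Θ w ++ τ s ∷ inv (Θ w)           ≈⟨ ++-[] _ ⟨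
      (Θ w ++ τ s ∷ inv (Θ w)) ++ []   ≈⟨ ++-congˡ (Θ w ++ τ s ∷ inv (Θ w)) (inverseʳ w) ⟨
      (Θ w ++ τ s ∷ inv (Θ w)) ++ w ++ inv w ≡⟨ List.++-assoc (Θ w) (τ s ∷ inv (Θ w)) _ ⟩
      Θ w ++ τ s ∷ inv (Θ w) ++ w ++ inv w   ≈⟨ ++-congˡ (Θ w) (∷-cong (τ s) (assoc (inv (Θ w)) w (inv w))) ⟨
      Θ w ++ τ s ∷ (inv (Θ w) ++ w) ++ inv w ≈⟨ ++-congˡ (Θ w) (++-congʳ (inv w) x-commutes) ⟩
      Θ w ++ ((inv (Θ w) ++ w) ++ [ s ]) ++ inv w ≡⟨ cong (Θ w ++_) (trans (List.++-assoc (inv (Θ w) ++ w) [ s ] (inv w)) (List.++-assoc (inv (Θ w)) w _)) ⟩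
      Θ w ++ inv (Θ w) ++ w ++ [ s ] ++ inv w     ≈⟨ assoc (Θ w) (inv (Θ w)) _ ⟨
      (Θ w ++ inv (Θ w)) ++ w ++ [ s ] ++ inv w   ≈⟨ ++-congʳ (w ++ [ s ] ++ inv w) (inverseʳ (Θ w)) ⟩
      w ++ [ s ] ++ inv w              ≡⟨ cong (λ - → - ++ [ s ] ++ inv -) (inv-inv w) ⟨
      t                                ∎
      where
      open ≈-Reasoning
      x-commutes : (τ s ∷ inv (Θ w) ++ w) ≈ ((inv (Θ w) ++ w) ++ [ s ])
      x-commutes = begin
        τ s ∷ inv (Θ w) ++ w            ≈⟨ ∷-cong (τ s) q ⟨
        τ s ∷ x                         ≈⟨ twist-snoc s x ⟨
        twist s x ++ [ s ]              ≈⟨ ++-congʳ [ s ] (≈.trans fix q) ⟩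
        (inv (Θ w) ++ w) ++ [ s ]       ∎
    even-mult : η (inv x) [ s ] ≡ false
    even-mult = begin
      η (inv x) [ s ]                     ≡⟨ η-cong [ s ] p ⟩
      η (inv w ++ Θ w) [ s ]              ≡⟨ η-++ (inv w) (Θ w) [ s ] ⟩
      η (inv w) [ s ] xor η (Θ w) t       ≡⟨ cong (η (inv w) [ s ] xor_) (trans (η-congʳ (Θ w) (≈.sym Θt≈t)) (η-Θ w t)) ⟩
      η (inv w) [ s ] xor η w t           ≡⟨ η-++ (inv w) w [ s ] ⟨
      η (inv w ++ w) [ s ]                ≡⟨ η-cong [ s ] (inverseˡ w) ⟩
      false                               ∎
      where open ≡-Reasoning
    odd-mult : η (inv x) [ s ] ≡ true
    odd-mult with Descends⇒Descent d
    ... | dx@(y , e , _) = trans (η-cong [ s ] inv-x) (η-head (subst Reduced (inv-++ y [ s ]) (Reduced-inv (Descent-Reduced (nf-Reduced x) dx))))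
      where
      inv-x : inv x ≈ (s ∷ inv y)
      inv-x = ≈.trans (inv-cong (≈.trans (≈.sym (nf-≈ x)) e)) (≈.reflexive (inv-++ y [ s ]))

  ℓ-inv-snoc : ∀ {x} s → IsTwistedIdentity x → ℓ (inv x ++ [ τ s ]) ≡ ℓ (x ++ [ s ])
  ℓ-inv-snoc {x} s ti = trans (ℓ-cong (≈.trans (++-congʳ [ τ s ] (inv≈Θ ti)) (≈.reflexive (sym (Θ-++ x [ s ]))))) (ℓ-Θ (x ++ [ s ]))

  Descends-inv : ∀ {x s} → IsTwistedIdentity x → Descends x s → Descends (inv x) (τ s)
  Descends-inv {x} {s} ti = subst₂ _<_ (sym (ℓ-inv-snoc s ti)) (sym (ℓ-inv x))

  Descends-inv⁻ : ∀ {x s} → IsTwistedIdentity x → Descends (inv x) (τ s) → Descends x s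
  Descends-inv⁻ {x} {s} ti = subst₂ _<_ (ℓ-inv-snoc s ti) (ℓ-inv x)

  -- Let y s be a reduced word for `x`. Exchange for `τ s` in s y⁻¹ removes the leading `s`, which
  -- would make `x` fixed under `twist s` and contradict `fixed⇒¬Descends`, or a letter of y⁻¹, as
  -- wanted. So the two factors of the twist shorten `x` one after the other.
  Descends-inv-snoc : ∀ {x s} → IsTwistedIdentity x → Descends x s → Descends (inv (x ++ [ s ])) (τ s)
  Descends-inv-snoc {x} {s} ti d = from-exchange (Descent⇒Exchange z-red z-desc)
    where
    dx = Descends⇒Descent d
    y  = proj₁ dx
    x≈ : x ≈ (y ++ [ s ])
    x≈ = ≈.trans (≈.sym (nf-≈ x)) (proj₁ (proj₂ dx))
    y≈ : y ≈ (x ++ [ s ])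
    y≈ = ≈.sym (snoc-swap x≈)
    y-red : Reduced (y ++ [ s ])
    y-red = Descent-Reduced (nf-Reduced x) dx
    z-red : Reduced (s ∷ inv y)
    z-red = subst Reduced (inv-++ y [ s ]) (Reduced-inv y-red)
    z≈ : inv x ≈ (s ∷ inv y)
    z≈ = ≈.trans (inv-cong x≈) (≈.reflexive (inv-++ y [ s ]))
    z-desc : Descent (s ∷ inv y) (τ s)
    z-desc = Descent-resp (≈.trans (nf-≈ (inv x)) z≈) (Reduced-length (nf-Reduced (inv x)) z-red (≈.trans (nf-≈ (inv x)) z≈))
      (Descends⇒Descent (Descends-inv ti d))
    from-exchange : Exchange (s ∷ inv y) (τ s) → Descends (inv (x ++ [ s ])) (τ s)
    from-exchange (exchange {[]} refl p) = contradiction d (fixed⇒¬Descends ti (≈.trans (twist-cong s x≈) (≈.sym (begin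
        x                        ≈⟨ x≈ ⟩
        y ++ [ s ]               ≡⟨ trans (inv-++ [ s ] (inv y)) (cong (_++ [ s ]) (inv-inv y)) ⟨
        inv (s ∷ inv y)          ≈⟨ inv-cong p ⟩
        inv (inv y ++ [ τ s ])   ≡⟨ trans (inv-++ (inv y) [ τ s ]) (cong (τ s ∷_) (inv-inv y)) ⟩
        τ s ∷ y                  ≈⟨ twist-snoc s y ⟨
        twist s y ++ [ s ]       ≡⟨⟩
        τ s ∷ (y ++ [ s ]) ++ [ s ] ∎))))
      where open ≈-Reasoning
    from-exchange (exchange {_ ∷ a} {b} e p) = Descends-resp (inv-cong y≈)
      (Descent⇒Descends (Descent-resp (≈.sym (nf-≈ (inv y))) (sym (Reduced-ℓ y-inv-red ≈.refl))
        (Exchange⇒Descent (exchange {a = a} {b} (List.∷-injectiveʳ e) p))))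
      where
      y-inv-red : Reduced (inv y)
      y-inv-red = Reduced-++ʳ [ s ] z-red

  module _ {x : Word} {s : Fin n} (ti : IsTwistedIdentity x) (d : Descends x s) where

    private
      twist≈ : inv (inv (x ++ [ s ]) ++ [ τ s ]) ≡ twist s x
      twist≈ = trans (inv-++ (inv (x ++ [ s ])) [ τ s ]) (cong (τ s ∷_) (inv-inv (x ++ [ s ])))

    ℓ-twist : ℓ (twist s x) < ℓ (x ++ [ s ])
    ℓ-twist = subst₂ _<_ (trans (sym (ℓ-inv _)) (cong ℓ twist≈)) (ℓ-inv (x ++ [ s ])) (Descends-inv-snoc ti d)

    twist-<B : twist s x <B x
    twist-<B = ≤B∧ℓ<⇒<B
      (≤B-trans (subst₂ _≤B_ twist≈ (inv-inv (x ++ [ s ])) (≤B-inv (descent-≤B (Descends-inv-snoc ti d)))) (descent-≤B d))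
      (ℕ.<-trans ℓ-twist d)

    -- Multiplying back by `s` gives θ(s) x, which is as long as x s since x⁻¹ = θ(x), and hence
    -- longer than the twist by `ℓ-twist`.
    twist-¬Descends : ¬ Descends (twist s x) s
    twist-¬Descends d′ = ℕ.<-asym d′ (subst (ℓ (twist s x) <_) (begin
      ℓ (x ++ [ s ])          ≡⟨ ℓ-inv-snoc s ti ⟨
      ℓ (inv x ++ [ τ s ])    ≡⟨ ℓ-inv (inv x ++ [ τ s ]) ⟨
      ℓ (inv (inv x ++ [ τ s ])) ≡⟨ cong ℓ (trans (inv-++ (inv x) [ τ s ]) (cong (τ s ∷_) (inv-inv x))) ⟩
      ℓ (τ s ∷ x)             ≡⟨ ℓ-cong (twist-snoc s x) ⟨
      ℓ (twist s x ++ [ s ])  ∎) ℓ-twist)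
      where open ≡-Reasoning

    -- Lifting is used on the right with `s` and then, for inverses, with `τ s`. The inverse of `z`
    -- lacks the descent `τ s` because `z` lacks `s`.
    twisted-lifting : ∀ {z} → IsTwistedIdentity z → z ≤B x → ¬ Descends z s → z ≤B twist s x
    twisted-lifting {z} tz z≤x ¬d = subst₂ _≤B_ (inv-inv z) twist≈
      (≤B-inv (lifting (≤B-inv (lifting z≤x ¬d d)) (¬d ∘ Descends-inv⁻ tz) (Descends-inv-snoc ti d)))

  last-letter : (r : Word) → r ≡ [] ⊎ ∃ λ x → ∃ λ s → r ≡ x ++ [ s ]
  last-letter r with initLast r
  ... | []      = inj₁ refl
  ... | x ∷ʳ′ s = inj₂ (x , s , refl)

  TI-[] : ∀ {x} → x ≈ [] → IsTwistedIdentity x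
  TI-[] e = TI-intro [] e

  -- Any right descent s of a twisted identity x leads to the shorter twisted
  -- identity θ(s) x s.
  IsTwistedIdentity? : ∀ x → Dec (IsTwistedIdentity x)
  IsTwistedIdentity? x = go (ℓ x) x ℕ.≤-refl
    where
    go : ∀ N x → ℓ x ≤ N → Dec (IsTwistedIdentity x)
    go N x l with last-letter (nf x)
    ... | inj₁ e = yes (TI-[] (≈.trans (≈.sym (nf-≈ x)) (≈.reflexive e)))
    ... | inj₂ (y , s , e) with ℓ (twist s x) ℕ.<? ℓ x
    ...   | no ¬l = no λ ti → ¬l (ℕ.<-trans (ℓ-twist ti d) d)
      where
      d : Descends x s
      d = Descent⇒Descends (y , ≈.reflexive e , trans (cong length e) (length-snoc y s))
    go zero    x l | inj₂ (y , s , e) | yes q with () ← ℕ.≤-trans q l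
    go (suc N) x l | inj₂ (y , s , e) | yes q =
      map′ (λ ti → TI-cong (twist-involutive s x) (TI-twist s ti)) (TI-twist s)
        (go N (twist s x) (ℕ.≤-pred (ℕ.≤-trans q l)))

  RightDescent⇒Descends : ∀ {v s} → RightDescent v s → Descends v s
  RightDescent⇒Descends (k , k′ , (r , e , red , refl) , (r′ , e′ , red′ , refl) , l) =
    subst₂ _<_ (sym (Reduced-ℓ red′ e′)) (sym (Reduced-ℓ red e)) l

  -- Equality with the empty word would force a repetition in the list of reflections of `[ s ]`,
  -- which has a single entry.
  generator-≉ : ∀ s → ¬ ([ s ] ≈ [])
  generator-≉ s e = no-repeat (pigeonhole (reflections [ s ]) {reflections []} (s≤s z≤n) (reflections-cong {[ s ]} {[]} e))
    where
    no-repeat : ∀ {x} → ¬ Repeats [ x ]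
    no-repeat (here ())
    no-repeat (there ())

  -- The second case of the definition would give u s = θ(s) u s and so make the generator θ(s)
  -- trivial.
  StarIs⇒fixed : ∀ {u s} → StarIs u s (u · [ s ]) → twist s u ≈ u
  StarIs⇒fixed {u} {s} (inj₁ (e , _)) = ≈.trans (++-congʳ (u ++ [ s ]) (≈.sym (proj₂ (θ-S s)))) e
  StarIs⇒fixed {u} {s} (inj₂ (_ , e)) = contradiction
    (≈.sym (cancelʳ (u ++ [ s ]) {[]} {[ τ s ]} (≈.trans e (++-congʳ (u ++ [ s ]) (proj₂ (θ-S s))))))
    (generator-≉ (τ s))

  open PosetCollapse _≈_ _<B_ <B-isStrictPartialOrder _≈?_ _<B?_ ℓ ℓ-cong <B⇒ℓ<
    using (Comparable; module Retraction)

  ≤B⇒Comparable : ∀ {x y} → x ≤B y → Comparable x y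
  ≤B⇒Comparable {x} {y} p with x ≈? y
  ... | yes e = inj₂ (inj₁ e)
  ... | no  n = inj₁ (p , n)

  open Collapse _≈_ using (Collapsible)

  interval-collapsible : ∀ {u v s} → IsTwistedIdentity u → IsTwistedIdentity v → u ≤B v →
    Descends v s → twist s u ≈ u → Collapsible (OrderComplexOpenInterval u v)
  interval-collapsible {u} {v} {s} tu tv u≤v dv fix = Retraction.collapsible
    {InOpenInterval u v} {λ x → ¬ Descends x s}
    (λ e (t , p , q) → TI-cong e t , proj₁ <-resp e p , proj₂ <-resp e q)
    (λ e ¬d d → ¬d (Descends-resp (≈.sym e) d))
    (λ x → IsTwistedIdentity? x ×-dec (u <B? x) ×-dec (x <B? v))
    (λ x → ¬? (Descends? x s))
    (subwords (nf v)) (λ (_ , _ , p , _) → ≤B⇒∈ p)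
    (ℓ v) (λ (_ , _ , p) → <B⇒ℓ< p)
    (λ {x} (t , u<x , x<v) ¬¬d →
      let d = decidable-stable (Descends? x s) ¬¬d in
      twist s x
      , (TI-twist s t , u<twist t d u<x , <B-≤B-trans (twist-<B t d) (proj₁ x<v))
      , twist-¬Descends t d
      , twist-<B t d
      , λ (ty , _) ¬dy (y≤x , _) → ≤B⇒Comparable (twisted-lifting t d ty y≤x ¬dy))
    (twist s v)
    (TI-twist s tv , u<twist tv dv (u≤v , λ u≈v → ¬du (Descends-resp (≈.sym u≈v) dv)) , twist-<B tv dv)
    (twist-¬Descends tv dv)
    (λ (ty , _ , y≤v , _) ¬dy → ≤B⇒Comparable (twisted-lifting tv dv ty y≤v ¬dy))
    where
    <-resp = IsStrictPartialOrder.<-resp-≈ <B-isStrictPartialOrder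
    ¬du : ¬ Descends u s
    ¬du = fixed⇒¬Descends tu fix
    u<twist : ∀ {x} → IsTwistedIdentity x → Descends x s → u <B x → u <B twist s x
    u<twist {x} t d (u≤x , u≉x) = twisted-lifting t d tu u≤x ¬du ,
      -- If `u` were the twist of `x`, then twisting back would give x = `twist s u`, which is `u`
      -- itself.
      λ e → u≉x (≈.trans (≈.sym fix) (twist-swap s e))

theorem4p8 : (n : ℕ) (M : CoxeterMatrix n) (A : Coxeter.Automorphism M) →
    Coxeter.Involutive M A →
    (u v : Coxeter.Word M) →
    Coxeter.Twisted.IsTwistedIdentity M A u →
    Coxeter.Twisted.IsTwistedIdentity M A v →
    Coxeter._≤B_ M u v →
    (s : Fin n) →
    Coxeter.RightDescent M v s →
    Coxeter.Twisted.StarIs M A u s (Coxeter._·_ M u [ s ]) →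
    Collapse.Collapsible (Coxeter._≈_ M)
    (Coxeter.Twisted.OrderComplexOpenInterval M A u v)
theorem4p8 n M A involutive u v tu tv u≤v s dv star =
  interval-collapsible tu tv u≤v (RightDescent⇒Descends dv) (StarIs⇒fixed star)
  where open TwistedIdentities M A involutive
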